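{- Let $m\geqslant 4$, $k$, $s_{m-2},s_{m-1},s_m$ be positive integers with $2\leqslant s_{m-2}\leqslant s_{m-1}\leqslant s_m$, and put $s_1=s_2=\dots=s_{m-3}=1$ and $\delta=\sum_{j=1}^m s_j=m-3+s_{m-2}+s_{m-1}+s_m$, and assume $\delta\leqslant k$. Consider the $\delta\times k$ matrices over $\mathbb{F}_2$ consisting of $m$ vertically stacked blocks, where for each $i\in\{1,\dots,m\}$ the $i$-th block has $s_i$ rows and its $r$-th row ($1\leqslant r\leqslant s_i$) is $(\alpha^{(i)}_r,\alpha^{(i)}_{r+1},\dots,\alpha^{(i)}_{r+k-1})$, with free parameters $\alpha^{(i)}_j\in\mathbb{F}_2$ for $1\leqslant j\leqslant s_i+k-1$. (Thus the first $m-3$ blocks are single arbitrary rows, and the last three blocks are persymmetric/Hankel $s_i\times k$ matrices.) Then the number of choices of the parameters $(\alpha^{(i)}_j)$ for which such a matrix has rank $\delta$ equals $$2^{\delta-m}\prod_{j=1}^{m}\left(2^{k}-2^{\delta-j}\right).$$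
   Context: Matrices of the described form are called $m$-times persymmetric matrices over the field $\mathbb{F}_2$ with two elements. The count is the number of parameter tuples $(\alpha^{(i)}_j)_{1\le i\le m,\,1\le j\le s_i+k-1}\in\mathbb{F}_2^{\sum_i (s_i+k-1)}$ giving a matrix of full row rank $\delta$. -}

module Defs where

open import Data.Bool using (Bool; true; false; _xor_; _∧_)
open import Data.Nat using (ℕ; zero; suc; _+_; _*_; _∸_; _^_; _≤_; _<_; s≤s)
open import Data.Nat.Properties using (+-suc; ∸-monoˡ-≤; +-mono-≤; ≤-trans; ≤-reflexive)
open import Data.Fin using (Fin; toℕ; fromℕ<)
open import Data.Fin.Properties using (toℕ<n)
open import Data.List using (List; []; _∷_; _++_; map; allFin; replicate; upTo; length)
open import Data.Nat.ListAction using (sum; product)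
open import Data.Vec using (Vec; lookup; splitAt; toList)
open import Data.Product using (Σ; ∃; _,_; _×_)
open import Relation.Binary.PropositionalEquality using (_≡_; sym)
open import Relation.Nullary using (¬_)

-- F₂ is modelled by Bool (addition = xor, multiplication = ∧).

hankel-bound : ∀ {s k} (r : Fin s) (c : Fin k) → toℕ r + toℕ c < s + k ∸ 1
hankel-bound {s} {k} r c =
  ≤-trans (≤-reflexive (sym (+-suc (toℕ r) (toℕ c))))
          (∸-monoˡ-≤ 1 (+-mono-≤ (toℕ<n r) (toℕ<n c)))

Row : ℕ → Set
Row k = Fin k → Bool

-- The s × k persymmetric (Hankel) block built from parameters
-- α₁ … α_{s+k-1}: row r (0-based) is (α_{r+1}, …, α_{r+k}).
hankelRows : (k s : ℕ) → Vec Bool (s + k ∸ 1) → List (Row k)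
hankelRows k s α = map (λ r c → lookup α (fromℕ< (hankel-bound r c))) (allFin s)

numParams : ℕ → List ℕ → ℕ
numParams k [] = 0
numParams k (s ∷ ss) = (s + k ∸ 1) + numParams k ss

stackedRows : (k : ℕ) (ss : List ℕ) → Vec Bool (numParams k ss) → List (Row k)
stackedRows k [] α = []
stackedRows k (s ∷ ss) α with splitAt (s + k ∸ 1) α
... | (β , γ , _) = hankelRows k s β ++ stackedRows k ss γ

lincomb : ∀ {k} → List Bool → List (Row k) → Row k
lincomb [] _ j = false
lincomb (_ ∷ _) [] j = false
lincomb (c ∷ cs) (r ∷ rs) j = (c ∧ r j) xor lincomb cs rs j

FullRowRank : ∀ {k} → List (Row k) → Set
FullRowRank {k} rows =
  (c : Vec Bool (length rows)) →
  (Σ (Fin (length rows)) λ i → lookup c i ≡ true) →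
  ¬ ((j : Fin k) → lincomb (toList c) rows j ≡ false)

blockSizes : (m a b c : ℕ) → List ℕ
blockSizes m a b c = replicate (m ∸ 3) 1 ++ (a ∷ b ∷ c ∷ [])

delta : (m a b c : ℕ) → ℕ
delta m a b c = sum (blockSizes m a b c)

formula : (m k δ : ℕ) → ℕ
formula m k δ = 2 ^ (δ ∸ m) * product (map (λ j → 2 ^ k ∸ 2 ^ (δ ∸ j)) (map suc (upTo m)))

{-# OPTIONS --safe #-}
-- Write sᵢ = tᵢ + 1 and D = Σ tᵢ = δ - m.  The parameters amount to an initial state x₀ ∈ F₂^D and inputs
-- b₀, …, b_{k-1} ∈ F₂^m of a bank of shift registers, and column j of the matrix is u_j = (x_j, b_j).
-- The rank is δ iff no nonzero w ∈ F₂^δ is orthogonal to all columns.  By inclusion-exclusion over w, the count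
-- is a signed sum of the numbers 2^{d(k)} of trajectories whose columns lie in a fixed subspace S^⊥.
-- Cutting a trajectory in two shows that d is subadditive; gluing two overlapping trajectories shows that it is
-- convex; and d(0) = D.  Hence d is affine on k ≥ D, of slope less than m if S ≠ 0.  So, for k ≥ D, the count is
-- 2^{D+mk} plus an integer combination of the 2^{jk} with j < m.  It vanishes for the m values D ≤ k < δ, where
-- there are fewer columns than rows, and this leaves only 2^D ∏_{j<m} (2^k - 2^{D+j}).
module Submission where

open import Defs
open import Data.Bool using (Bool; true; false; _xor_; _∧_; if_then_else_)
open import Data.Bool.Properties using (xor-comm; xor-assoc; xor-same; xor-identityʳ; ∧-distribˡ-xor; ∧-comm; ∧-zeroʳ; xor-∧-commutativeRing)
open import Data.Empty using (⊥-elim)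
open import Data.Fin using (Fin; zero; suc; toℕ; fromℕ<)
import Data.Integer as ℤ
import Data.Integer.Properties as ℤ
import Data.Integer.Tactic.RingSolver as ℤSolver
open import Data.List using (List; []; _∷_; _++_; length; map; replicate; allFin; tabulate; filter; cartesianProductWith; upTo; applyUpTo)
open import Data.List.Properties using (map-++; map-∘; map-cong; length-map; length-tabulate; length-++; map-tabulate; map-replicate; length-replicate; map-applyUpTo)
open import Data.List.Membership.Propositional using (_∈_)
open import Data.List.Membership.Propositional.Properties using (∈-cartesianProductWith⁺; ∈-filter⁺; ∈-filter⁻; ∈-map⁺; ∈-map⁻; ∈-++⁺ˡ; ∈-++⁺ʳ; ∈-++⁻)
open import Data.List.Relation.Unary.All as All using (All; []; _∷_)
open import Data.List.Relation.Unary.All.Properties using (all-filter)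
open import Data.List.Relation.Unary.AllPairs using ([]; _∷_)
open import Data.List.Relation.Unary.Any using (here; there)
open import Data.List.Relation.Unary.Unique.Propositional using (Unique)
import Data.List.Relation.Unary.Unique.Propositional.Properties as Unique
open import Data.Nat as ℕ using (ℕ; zero; suc; z≤n; s≤s)
import Data.Nat.Properties as ℕ
open import Data.Nat.ListAction using (sum; product)
open import Data.Nat.ListAction.Properties using (sum-++)
open import Data.Product using (Σ; ∃; _,_; _×_; proj₁; proj₂)
open import Data.Sum using (inj₁; inj₂)
open import Data.Unit using (⊤; tt)
open import Data.Vec as Vec using (Vec; []; _∷_; lookup; splitAt; toList)
open import Data.Vec.Properties using (++-injective; length-toList; toList-cast; toList∘fromList)
open import Algebra.Bundles using (CommutativeRing)
open import Algebra.Properties.CommutativeSemigroup using (interchange)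
open import Function using (_∘_; id)
open import Function.Bundles using (_⇔_; mk⇔)
open import Relation.Nullary using (¬_; Dec; yes; no)
open import Relation.Nullary.Decidable using (¬?)
open import Relation.Binary.PropositionalEquality

-- For a given S neither the slope of d nor its values before k = D are ever computed; only facts
-- that are uniform in S enter. The matrices provide zeros exactly for D ≤ k < D + m, that is, m
-- zeros for m unknown coefficients of the 2^{jk}, so an affine range starting even one step later
-- would leave too few zeros. The value d(0) = D is what makes it start in time. The slope is less
-- than m for S ≠ 0 by controllability. A functional that involves an input halves the admissible
-- inputs at every step. A nonzero functional of the state alone can be pulled back through the
-- dynamics, and since the registers are finite it involves an input after finitely many pull-backs;
-- each costs only a constant factor, which the slope does not see.

-- Integer sequences: convex subadditive growth.

module IntegerSequences where
  open import Data.Integer using (ℤ; +_; 0ℤ; 1ℤ; _+_; _-_; _*_; -_; _≤_; +≤+; ∣_∣)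
  open ℤSolver using (solve-∀)

  -- Subadditivity forces n · slope L ≤ d n, convexity forces d (1 + K) ≤ D + (1 + K) · slope K;
  -- so slope L ≤ slope K as soon as K ≥ D = d 0.
  module ConvexSubadditive (d : ℕ → ℕ)
    (subadditive : ∀ j k → d (j ℕ.+ k) ℕ.≤ d j ℕ.+ d k)
    (convex : ∀ k → d (suc k) ℕ.+ d (suc k) ℕ.≤ d k ℕ.+ d (suc (suc k))) where

    D : ℕ
    D = d 0

    slope : ℕ → ℤ
    slope k = + d (suc k) - + d k

    d-suc : ∀ k → + d (suc k) ≡ + d k + slope k
    d-suc k = lemma (+ d (suc k)) (+ d k)
      where lemma : ∀ x y → x ≡ y + (x - y)
            lemma = solve-∀

    slope-mono-suc : ∀ k → slope k ≤ slope (suc k)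
    slope-mono-suc k = subst₂ _≤_ (lemma₁ (+ d (suc k)) (+ d k)) (lemma₂ (+ d (suc k)) (+ d k) (+ d (suc (suc k))))
      (ℤ.+-monoˡ-≤ (- + d (suc k) - + d k) (+≤+ (convex k)))
      where lemma₁ : ∀ x y → x + x + (- x - y) ≡ x - y
            lemma₁ = solve-∀
            lemma₂ : ∀ x y z → y + z + (- x - y) ≡ z - x
            lemma₂ = solve-∀

    slope-mono-+ : ∀ k n → slope k ≤ slope (n ℕ.+ k)
    slope-mono-+ k zero = ℤ.≤-refl
    slope-mono-+ k (suc n) = ℤ.≤-trans (slope-mono-+ k n) (slope-mono-suc (n ℕ.+ k))

    slope-mono : ∀ {k l} → k ℕ.≤ l → slope k ≤ slope l
    slope-mono {k} {l} k≤l = subst (λ n → slope k ≤ slope n) (ℕ.m∸n+n≡m k≤l) (slope-mono-+ k (l ℕ.∸ k))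

    suc-* : ∀ n x → + n * x + x ≡ + suc n * x
    suc-* n x = trans (lemma (+ n) x) (cong (_* x) (sym (ℤ.pos-+ 1 n)))
      where lemma : ∀ m x → m * x + x ≡ (1ℤ + m) * x
            lemma = solve-∀

    d-upper : ∀ K n → n ℕ.≤ suc K → + d n ≤ + D + + n * slope K
    d-upper K zero _ = ℤ.≤-reflexive (sym (ℤ.+-identityʳ (+ D)))
    d-upper K (suc n) (s≤s n≤K) = begin
      + d (suc n)                          ≡⟨ d-suc n ⟩
      + d n + slope n                      ≤⟨ ℤ.+-mono-≤ (d-upper K n (ℕ.m≤n⇒m≤1+n n≤K)) (slope-mono n≤K) ⟩
      + D + + n * slope K + slope K        ≡⟨ ℤ.+-assoc (+ D) (+ n * slope K) (slope K) ⟩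
      + D + (+ n * slope K + slope K)      ≡⟨ cong (_+_ (+ D)) (suc-* n (slope K)) ⟩
      + D + + suc n * slope K              ∎
      where open ℤ.≤-Reasoning

    d-lower : ∀ L n → + d L + + n * slope L ≤ + d (n ℕ.+ L)
    d-lower L zero = ℤ.≤-reflexive (ℤ.+-identityʳ (+ d L))
    d-lower L (suc n) = begin
      + d L + + suc n * slope L            ≡⟨ cong (_+_ (+ d L)) (suc-* n (slope L)) ⟨
      + d L + (+ n * slope L + slope L)    ≡⟨ ℤ.+-assoc (+ d L) (+ n * slope L) (slope L) ⟨
      + d L + + n * slope L + slope L      ≤⟨ ℤ.+-mono-≤ (d-lower L n) (slope-mono-+ L n) ⟩
      + d (n ℕ.+ L) + slope (n ℕ.+ L)      ≡⟨ d-suc (n ℕ.+ L) ⟨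
      + d (suc n ℕ.+ L)                    ∎
      where open ℤ.≤-Reasoning

    -- `d L + n · slope L ≤ d (n + L) ≤ d n + d L`, and `d L` cancels. Thus a slope found
    -- arbitrarily late already constrains `d` at the early index `n`.
    slope-bound : ∀ L n → + n * slope L ≤ + d n
    slope-bound L n = subst₂ _≤_ (lemma (+ d L) _) (lemma (+ d L) _)
      (ℤ.+-monoʳ-≤ (- + d L) (ℤ.≤-trans (d-lower L n)
        (+≤+ (subst (d (n ℕ.+ L) ℕ.≤_) (ℕ.+-comm (d n) (d L)) (subadditive n L)))))
      where lemma : ∀ x y → - x + (x + y) ≡ y
            lemma = solve-∀

    -- A slope s with (1 + K) (1 + s) ≤ d (1 + K) ≤ D + (1 + K) s would give 1 + K ≤ D.
    no-larger-slope : ∀ {K} s → D ℕ.≤ K → slope K ≤ s → ¬ (+ suc K * (1ℤ + s) ≤ + d (suc K))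
    no-larger-slope {K} s D≤K K≤s le = ℕ.<⇒≱ (s≤s D≤K) (ℤ.drop‿+≤+ (begin
      + suc K                                  ≡⟨ lemma (+ suc K) s ⟩
      + suc K * (1ℤ + s) - + suc K * s         ≤⟨ ℤ.+-monoˡ-≤ (- (+ suc K * s)) (ℤ.≤-trans le (d-upper K (suc K) ℕ.≤-refl)) ⟩
      + D + + suc K * slope K - + suc K * s    ≤⟨ ℤ.+-monoˡ-≤ (- (+ suc K * s)) (ℤ.+-monoʳ-≤ (+ D) (ℤ.*-monoˡ-≤-nonNeg (+ suc K) K≤s)) ⟩
      + D + + suc K * s - + suc K * s          ≡⟨ lemma' (+ D) (+ suc K * s) ⟩
      + D                                      ∎))
      where
      open ℤ.≤-Reasoning
      lemma : ∀ x s → x ≡ x * (1ℤ + s) - x * s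
      lemma = solve-∀
      lemma' : ∀ x y → x + y - y ≡ x
      lemma' = solve-∀

    -- Convexity gives one inequality. Slopes are integers, so a larger one would exceed `slope D`
    -- by at least 1, and `slope-bound` at `suc D` would contradict `no-larger-slope`.
    slope-const : ∀ n → slope (n ℕ.+ D) ≡ slope D
    slope-const n with slope (n ℕ.+ D) ℤ.≤? slope D
    ... | yes le = ℤ.≤-antisym le (slope-mono-+ D n)
    ... | no ≰ = ⊥-elim (no-larger-slope (slope D) ℕ.≤-refl ℤ.≤-refl
        (ℤ.≤-trans (ℤ.*-monoˡ-≤-nonNeg (+ suc D) (ℤ.i<j⇒suc[i]≤j (ℤ.≰⇒> ≰)))
                   (slope-bound (n ℕ.+ D) (suc D))))

    0≤slope : 0ℤ ≤ slope D
    0≤slope with 0ℤ ℤ.≤? slope D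
    ... | yes le = le
    -- A negative slope is at most `- 1ℤ`; this choice of `s` makes `1ℤ + s` vanish, so the
    -- inequality that `no-larger-slope` forbids is just `0 ≤ d (suc D)`.
    ... | no ≰ = ⊥-elim (no-larger-slope (- 1ℤ) ℕ.≤-refl (ℤ.i<j⇒i≤pred[j] (ℤ.≰⇒> ≰))
        (subst (_≤ + d (suc D)) (sym (ℤ.*-zeroʳ (+ suc D))) (+≤+ z≤n)))

    rate : ℕ
    rate = ∣ slope D ∣

    rate≡slope : + rate ≡ slope D
    rate≡slope = ℤ.0≤i⇒+∣i∣≡i 0≤slope

    affine : ∀ k → d (k ℕ.+ D) ≡ k ℕ.* rate ℕ.+ d D
    affine zero = refl
    affine (suc k) = trans (ℤ.+-injective (begin
      + d (suc k ℕ.+ D)                 ≡⟨ d-suc (k ℕ.+ D) ⟩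
      + d (k ℕ.+ D) + slope (k ℕ.+ D)   ≡⟨ cong₂ _+_ (cong +_ (affine k)) (trans (slope-const k) (sym rate≡slope)) ⟩
      + (k ℕ.* rate ℕ.+ d D ℕ.+ rate)   ∎))
      (trans (ℕ.+-comm _ rate) (sym (ℕ.+-assoc rate (k ℕ.* rate) (d D))))
      where open ≡-Reasoning

    rate-bound : ∀ n → n ℕ.* rate ℕ.≤ d n
    rate-bound n = ℤ.drop‿+≤+ (subst (_≤ + d n)
      (trans (cong (+ n *_) (sym rate≡slope)) (sym (ℤ.pos-* n rate))) (slope-bound D n))

    -- With `rate ≥ m` the left side would be at least `n + n * m`, which exceeds the right side as
    -- soon as `n = suc C`.
    rate<m : ∀ m C → (∀ n → n ℕ.+ d n ℕ.≤ C ℕ.+ n ℕ.* m) → rate ℕ.< m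
    rate<m m C bd with rate ℕ.<? m
    ... | yes lt = lt
    ... | no ≮ = ⊥-elim (ℕ.1+n≰n (ℕ.+-cancelʳ-≤ (suc C ℕ.* m) (suc C) C
      (ℕ.≤-trans (ℕ.+-monoʳ-≤ (suc C) (ℕ.≤-trans (ℕ.*-monoʳ-≤ (suc C) (ℕ.≮⇒≥ ≮)) (rate-bound (suc C))))
                 (bd (suc C)))))

  -- Linear recurrences with roots 1, 2, 4, ...

  2^_ : ℕ → ℤ
  2^ n = + (2 ℕ.^ n)

  2^-+ : ∀ m n → 2^ (m ℕ.+ n) ≡ 2^ m * 2^ n
  2^-+ m n = trans (cong +_ (ℕ.^-distribˡ-+-* 2 m n)) (ℤ.pos-* (2 ℕ.^ m) (2 ℕ.^ n))

  2^-suc : ∀ n → 2^ (suc n) ≡ + 2 * 2^ n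
  2^-suc n = 2^-+ 1 n

  -- Exp n f: f is annihilated by (E - 1)(E - 2)⋯(E - 2ⁿ⁻¹), E the shift.
  data Exp : ℕ → (ℕ → ℤ) → Set where
    annihilated : ∀ {f} → (∀ k → f k ≡ 0ℤ) → Exp 0 f
    shifted : ∀ {n f} → Exp n (λ k → f (suc k) - 2^ n * f k) → Exp (suc n) f

  exp-cong : ∀ {n} {f g : ℕ → ℤ} → (∀ k → f k ≡ g k) → Exp n f → Exp n g
  exp-cong e (annihilated r) = annihilated λ k → trans (sym (e k)) (r k)
  exp-cong {suc n} e (shifted r) = shifted (exp-cong (λ k → cong₂ _-_ (e (suc k)) (cong (2^ n *_) (e k))) r)

  exp-zero : ∀ n → Exp n λ _ → 0ℤ
  exp-zero zero = annihilated λ _ → refl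
  exp-zero (suc n) = shifted (exp-cong (λ k → sym (lemma (2^ n))) (exp-zero n))
    where lemma : ∀ x → 0ℤ - x * 0ℤ ≡ 0ℤ
          lemma = solve-∀

  exp-* : ∀ {n} c {f : ℕ → ℤ} → Exp n f → Exp n λ k → c * f k
  exp-* c (annihilated r) = annihilated λ k → trans (cong (c *_) (r k)) (ℤ.*-zeroʳ c)
  exp-* {suc n} c {f} (shifted r) = shifted (exp-cong (λ k → lemma c (2^ n) (f (suc k)) (f k)) (exp-* c r))
    where lemma : ∀ c e x y → c * (x - e * y) ≡ c * x - e * (c * y)
          lemma = solve-∀

  exp-- : ∀ {n} {f g : ℕ → ℤ} → Exp n f → Exp n g → Exp n λ k → f k - g k
  exp-- (annihilated r) (annihilated s) = annihilated λ k → cong₂ _-_ (r k) (s k)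
  exp-- {suc n} {f} {g} (shifted r) (shifted s) =
    shifted (exp-cong (λ k → lemma (2^ n) (f (suc k)) (f k) (g (suc k)) (g k)) (exp-- r s))
    where lemma : ∀ e x y z w → (x - e * y) - (z - e * w) ≡ (x - z) - e * (y - w)
          lemma = solve-∀

  -- The sequence is an eigenvector of each `E - 2ⁱ` with eigenvalue `2ʲ - 2ⁱ`: the factor with
  -- `i = j` kills it, and the others only change the constant `c`.
  exp-geometric : ∀ n j → j ℕ.< n → ∀ c → Exp n λ k → c * 2^ (k ℕ.* j)
  exp-geometric (suc n) j (s≤s j≤n) c = shifted (exp-cong (λ k → sym (step k)) (aux (j ℕ.≟ n)))
    where
    step : ∀ k → c * 2^ (suc k ℕ.* j) - 2^ n * (c * 2^ (k ℕ.* j)) ≡ (2^ j - 2^ n) * c * 2^ (k ℕ.* j)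
    step k = trans (cong (λ z → c * z - 2^ n * (c * 2^ (k ℕ.* j))) (2^-+ j (k ℕ.* j)))
                   (lemma c (2^ j) (2^ n) (2^ (k ℕ.* j)))
      where lemma : ∀ c a b x → c * (a * x) - b * (c * x) ≡ (a - b) * c * x
            lemma = solve-∀
    aux : Dec (j ≡ n) → Exp n λ k → (2^ j - 2^ n) * c * 2^ (k ℕ.* j)
    aux (yes refl) = exp-cong (λ k → sym (lemma (2^ j) c (2^ (k ℕ.* j)))) (exp-zero n)
      where lemma : ∀ a c x → (a - a) * c * x ≡ 0ℤ
            lemma = solve-∀
    aux (no j≢n) = exp-geometric n j (ℕ.≤∧≢⇒< j≤n j≢n) ((2^ j - 2^ n) * c)

  -- Multiplication by `2^ k` doubles the roots. The doubled roots together with 1 are again an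
  -- initial segment of the powers of two, whence `suc n`.
  exp-2^* : ∀ {n} {f : ℕ → ℤ} → Exp n f → Exp (suc n) λ k → 2^ k * f k
  exp-2^* (annihilated r) = exp-cong (λ k → sym (trans (cong (2^ k *_) (r k)) (ℤ.*-zeroʳ (2^ k)))) (exp-zero 1)
  exp-2^* {suc n} {f} (shifted r) = shifted (exp-cong step (exp-* (+ 2) (exp-2^* r)))
    where
    step : ∀ k → + 2 * (2^ k * (f (suc k) - 2^ n * f k)) ≡ 2^ suc k * f (suc k) - 2^ suc n * (2^ k * f k)
    step k = trans (lemma (2^ k) (2^ n) (f (suc k)) (f k))
      (sym (cong₂ (λ a b → a * f (suc k) - b * (2^ k * f k)) (2^-suc k) (2^-suc n)))
      where lemma : ∀ a b x y → + 2 * (a * (x - b * y)) ≡ (+ 2 * a) * x - (+ 2 * b) * (a * y)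
            lemma = solve-∀

  -- In `Exp` the factor with the largest root acts first. To put a new one in front without
  -- commuting operators, write `E - 2ⁿ⁺¹` as `(E - 2ⁿ) - 2ⁿ`.
  exp-suc : ∀ {n} {f : ℕ → ℤ} → Exp n f → Exp (suc n) f
  exp-suc (annihilated r) = exp-cong (λ k → sym (r k)) (exp-zero 1)
  exp-suc {suc n} {f} (shifted r) = shifted (exp-cong
    (λ k → trans (lemma (2^ n) (f (suc k)) (f k)) (cong (λ e → f (suc k) - e * f k) (sym (2^-suc n))))
    (exp-- (exp-suc r) (exp-* (2^ n) (shifted {f = f} r))))
    where lemma : ∀ a x y → (x - a * y) - a * y ≡ x - (+ 2 * a) * y
          lemma = solve-∀

  exp-vanish : ∀ {n} {f : ℕ → ℤ} → Exp n f → (∀ k → k ℕ.< n → f k ≡ 0ℤ) → ∀ k → f k ≡ 0ℤ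
  exp-vanish (annihilated r) z = r
  exp-vanish {suc n} {f} (shifted r) z = all
    where
    lemma : ∀ x → 0ℤ - x * 0ℤ ≡ 0ℤ
    lemma = solve-∀
    recurrence : ∀ k → f (suc k) - 2^ n * f k ≡ 0ℤ
    recurrence = exp-vanish r λ k k<n → trans
      (cong₂ (λ a b → a - 2^ n * b) (z (suc k) (s≤s k<n)) (z k (ℕ.m≤n⇒m≤1+n k<n))) (lemma (2^ n))
    all : ∀ k → f k ≡ 0ℤ
    all zero = z 0 (s≤s z≤n)
    all (suc k) = trans (ℤ.i-j≡0⇒i≡j _ _ (recurrence k)) (trans (cong (2^ n *_) (all k)) (ℤ.*-zeroʳ (2^ n)))

  -- The number of linearly independent m-tuples in F₂^k; as a polynomial in 2^k it is monic with
  -- roots 1, 2, ..., 2^{m-1}.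
  falling : ℕ → ℕ → ℤ
  falling zero k = 1ℤ
  falling (suc m) k = (2^ k - 2^ m) * falling m k

  falling-zero : ∀ m k → k ℕ.< m → falling m k ≡ 0ℤ
  falling-zero (suc m) k (s≤s k≤m) with k ℕ.≟ m
  ... | yes refl = cong (_* falling m k) (ℤ.+-inverseʳ (2^ k))
  ... | no k≢m = trans (cong ((2^ k - 2^ m) *_) (falling-zero m k (ℕ.≤∧≢⇒< k≤m k≢m))) (ℤ.*-zeroʳ (2^ k - 2^ m))

  -- A monic polynomial of degree m in 2^k loses its leading term, so only powers 2^{jk} with j < m
  -- remain.
  exp-falling : ∀ m → Exp m λ k → falling m k - 2^ (k ℕ.* m)
  exp-falling zero = annihilated λ k → cong (λ n → 1ℤ - 2^ n) (ℕ.*-zeroʳ k)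
  exp-falling (suc m) = exp-cong step
    (exp-- (exp-2^* (exp-falling m))
      (exp-- (exp-* (2^ m) (exp-suc (exp-falling m)))
             (exp-geometric (suc m) m ℕ.≤-refl (- 2^ m))))
    where
    step : ∀ k → 2^ k * (falling m k - 2^ (k ℕ.* m)) -
                 (2^ m * (falling m k - 2^ (k ℕ.* m)) - (- 2^ m) * 2^ (k ℕ.* m)) ≡
                 falling (suc m) k - 2^ (k ℕ.* suc m)
    step k = trans (lemma (2^ k) (2^ m) (falling m k) (2^ (k ℕ.* m)))
      (cong (λ z → falling (suc m) k - z) (sym (trans (cong 2^_ (ℕ.*-suc k m)) (2^-+ k (k ℕ.* m)))))
      where lemma : ∀ a b f x → a * (f - x) - (b * (f - x) - (- b) * x) ≡ (a - b) * f - a * x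
            lemma = solve-∀

  -- Subtracting `c * falling m k` removes the term in 2^{mk} without disturbing the m zeros, so
  -- `exp-vanish` applies to the difference.
  exp-determined : ∀ m c (f : ℕ → ℤ) → Exp m (λ k → f k - c * 2^ (k ℕ.* m)) →
    (∀ k → k ℕ.< m → f k ≡ 0ℤ) → ∀ k → f k ≡ c * falling m k
  exp-determined m c f r z k = ℤ.i-j≡0⇒i≡j _ _ (exp-vanish
    (exp-cong (λ k → lemma (f k) c (2^ (k ℕ.* m)) (falling m k))
      (exp-- r (exp-* c (exp-falling m))))
    (λ k k<m → trans (cong₂ (λ a b → a - c * b) (z k k<m) (falling-zero m k k<m)) (lemma0 c)) k)
    where lemma : ∀ f c x p → (f - c * x) - c * (p - x) ≡ f - c * p
          lemma = solve-∀
          lemma0 : ∀ c → 0ℤ - c * 0ℤ ≡ 0ℤ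
          lemma0 = solve-∀

open IntegerSequences
open import Data.Nat using (_+_; _*_; _∸_; _^_; _≤_; _<_; _≟_; _≤?_; s<s⁻¹)
open import Data.Nat.Properties hiding (_≟_; _≤?_)
open import Data.Nat.Tactic.RingSolver using (solve-∀)

-- Finite vector spaces over F₂ and sums over them.

xor-interchange : ∀ a b c d → (a xor b) xor (c xor d) ≡ (a xor c) xor (b xor d)
xor-interchange = interchange (CommutativeRing.+-commutativeSemigroup xor-∧-commutativeRing)

data Space : Set where
  𝟘 𝔽 : Space
  _⊗_ : Space → Space → Space

infixr 5 _⊗_ _&_
infixl 6 _⊕_

-- An indexed datatype, not a function on codes: `⟦_⟧` is then injective for unification, and the
-- space is inferred from its vectors.
data ⟦_⟧ : Space → Set where
  ∙   : ⟦ 𝟘 ⟧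
  bit : Bool → ⟦ 𝔽 ⟧
  _&_ : ∀ {V W} → ⟦ V ⟧ → ⟦ W ⟧ → ⟦ V ⊗ W ⟧

dim : Space → ℕ
dim 𝟘 = 0
dim 𝔽 = 1
dim (V ⊗ W) = dim V + dim W

0# : ∀ {V} → ⟦ V ⟧
0# {𝟘} = ∙
0# {𝔽} = bit false
0# {V ⊗ W} = 0# & 0#

_⊕_ : ∀ {V} → ⟦ V ⟧ → ⟦ V ⟧ → ⟦ V ⟧
∙ ⊕ ∙ = ∙
bit a ⊕ bit b = bit (a xor b)
(x & y) ⊕ (x' & y') = (x ⊕ x') & (y ⊕ y')

⊕-comm : ∀ {V} (x y : ⟦ V ⟧) → x ⊕ y ≡ y ⊕ x
⊕-comm ∙ ∙ = refl
⊕-comm (bit a) (bit b) = cong bit (xor-comm a b)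
⊕-comm (x & y) (x' & y') = cong₂ _&_ (⊕-comm x x') (⊕-comm y y')

⊕-assoc : ∀ {V} (x y z : ⟦ V ⟧) → (x ⊕ y) ⊕ z ≡ x ⊕ (y ⊕ z)
⊕-assoc ∙ ∙ ∙ = refl
⊕-assoc (bit a) (bit b) (bit c) = cong bit (xor-assoc a b c)
⊕-assoc (x & y) (x' & y') (x'' & y'') = cong₂ _&_ (⊕-assoc x x' x'') (⊕-assoc y y' y'')

⊕-identityʳ : ∀ {V} (x : ⟦ V ⟧) → x ⊕ 0# ≡ x
⊕-identityʳ ∙ = refl
⊕-identityʳ (bit a) = cong bit (xor-identityʳ a)
⊕-identityʳ (x & y) = cong₂ _&_ (⊕-identityʳ x) (⊕-identityʳ y)

⊕-identityˡ : ∀ {V} (x : ⟦ V ⟧) → 0# ⊕ x ≡ x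
⊕-identityˡ x = trans (⊕-comm 0# x) (⊕-identityʳ x)

⊕-self : ∀ {V} (x : ⟦ V ⟧) → x ⊕ x ≡ 0#
⊕-self ∙ = refl
⊕-self (bit a) = cong bit (xor-same a)
⊕-self (x & y) = cong₂ _&_ (⊕-self x) (⊕-self y)

⊕-cancelˡ : ∀ {V} (x y : ⟦ V ⟧) → x ⊕ (x ⊕ y) ≡ y
⊕-cancelˡ x y = trans (sym (⊕-assoc x x y)) (trans (cong (_⊕ y) (⊕-self x)) (⊕-identityˡ y))

_≟0# : ∀ {V} (x : ⟦ V ⟧) → Dec (x ≡ 0#)
∙ ≟0# = yes refl
bit false ≟0# = yes refl
bit true ≟0# = no λ ()
(x & y) ≟0# with x ≟0# | y ≟0#
... | yes refl | yes refl = yes refl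
... | no x≢0 | _ = no λ { refl → x≢0 refl }
... | yes _ | no y≢0 = no λ { refl → y≢0 refl }

∑ : (V : Space) → (⟦ V ⟧ → ℕ) → ℕ
∑ 𝟘 f = f ∙
∑ 𝔽 f = f (bit false) + f (bit true)
∑ (V ⊗ W) f = ∑ V λ x → ∑ W λ y → f (x & y)

∑-cong : ∀ V {f g : ⟦ V ⟧ → ℕ} → (∀ x → f x ≡ g x) → ∑ V f ≡ ∑ V g
∑-cong 𝟘 e = e ∙
∑-cong 𝔽 e = cong₂ _+_ (e (bit false)) (e (bit true))
∑-cong (V ⊗ W) e = ∑-cong V λ x → ∑-cong W λ y → e (x & y)

∑-mono-≤ : ∀ V {f g : ⟦ V ⟧ → ℕ} → (∀ x → f x ≤ g x) → ∑ V f ≤ ∑ V g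
∑-mono-≤ 𝟘 e = e ∙
∑-mono-≤ 𝔽 e = +-mono-≤ (e (bit false)) (e (bit true))
∑-mono-≤ (V ⊗ W) e = ∑-mono-≤ V λ x → ∑-mono-≤ W λ y → e (x & y)

∑-+ : ∀ V (f g : ⟦ V ⟧ → ℕ) → ∑ V (λ x → f x + g x) ≡ ∑ V f + ∑ V g
∑-+ 𝟘 f g = refl
∑-+ 𝔽 f g = interchange +-commutativeSemigroup (f (bit false)) (g (bit false)) (f (bit true)) (g (bit true))
∑-+ (V ⊗ W) f g = trans (∑-cong V λ x → ∑-+ W (λ y → f (x & y)) (λ y → g (x & y)))
                        (∑-+ V _ _)

∑-*ˡ : ∀ V (c : ℕ) (f : ⟦ V ⟧ → ℕ) → ∑ V (λ x → c * f x) ≡ c * ∑ V f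
∑-*ˡ 𝟘 c f = refl
∑-*ˡ 𝔽 c f = sym (*-distribˡ-+ c (f (bit false)) (f (bit true)))
∑-*ˡ (V ⊗ W) c f = trans (∑-cong V λ x → ∑-*ˡ W c (λ y → f (x & y))) (∑-*ˡ V c _)

∑-*ʳ : ∀ V (c : ℕ) (f : ⟦ V ⟧ → ℕ) → ∑ V (λ x → f x * c) ≡ ∑ V f * c
∑-*ʳ V c f = trans (∑-cong V λ x → *-comm (f x) c) (trans (∑-*ˡ V c f) (*-comm c _))

∑-swap : ∀ V W (f : ⟦ V ⟧ → ⟦ W ⟧ → ℕ) →
         ∑ V (λ x → ∑ W λ y → f x y) ≡ ∑ W (λ y → ∑ V λ x → f x y)
∑-swap 𝟘 W f = refl
∑-swap 𝔽 W f = sym (∑-+ W _ _)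
∑-swap (V ⊗ V') W f = trans (∑-cong V λ x → ∑-swap V' W λ x' → f (x & x')) (∑-swap V W _)

∑-const : ∀ V (c : ℕ) → ∑ V (λ _ → c) ≡ 2 ^ dim V * c
∑-const 𝟘 c = sym (+-identityʳ c)
∑-const 𝔽 c = cong (c +_) (sym (+-identityʳ c))
∑-const (V ⊗ W) c = begin
  ∑ V (λ _ → ∑ W λ _ → c)        ≡⟨ ∑-cong V (λ _ → ∑-const W c) ⟩
  ∑ V (λ _ → 2 ^ dim W * c)      ≡⟨ ∑-const V _ ⟩
  2 ^ dim V * (2 ^ dim W * c)    ≡⟨ *-assoc (2 ^ dim V) _ c ⟨
  2 ^ dim V * 2 ^ dim W * c      ≡⟨ cong (_* c) (^-distribˡ-+-* 2 (dim V) (dim W)) ⟨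
  2 ^ (dim V + dim W) * c        ∎
  where open ≡-Reasoning

∑-shift : ∀ V (a : ⟦ V ⟧) (f : ⟦ V ⟧ → ℕ) → ∑ V (λ x → f (x ⊕ a)) ≡ ∑ V f
∑-shift 𝟘 ∙ f = refl
∑-shift 𝔽 (bit false) f = refl
∑-shift 𝔽 (bit true) f = +-comm (f (bit true)) (f (bit false))
∑-shift (V ⊗ W) (a & b) f = trans (∑-cong V λ x → ∑-shift W b λ y → f ((x ⊕ a) & y))
                                  (∑-shift V a λ x → ∑ W λ y → f (x & y))

∑-zero : ∀ V {f : ⟦ V ⟧ → ℕ} → (∀ x → f x ≡ 0) → ∑ V f ≡ 0
∑-zero V e = trans (∑-cong V e) (trans (∑-const V 0) (*-zeroʳ (2 ^ dim V)))

∑-ub : ∀ V (f : ⟦ V ⟧ → ℕ) x → f x ≤ ∑ V f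
∑-ub 𝟘 f ∙ = ≤-refl
∑-ub 𝔽 f (bit false) = m≤m+n _ _
∑-ub 𝔽 f (bit true) = m≤n+m _ _
∑-ub (V ⊗ W) f (x & y) = ≤-trans (∑-ub W (λ y → f (x & y)) y) (∑-ub V _ x)

∑-support : ∀ V (f : ⟦ V ⟧ → ℕ) → ∑ V f ≢ 0 → ∃ λ x → f x ≢ 0
∑-support 𝟘 f nz = ∙ , nz
∑-support 𝔽 f nz with f (bit false) in eq
... | zero = bit true , nz
... | suc n = bit false , λ z → 0≢1+n (trans (sym z) eq)
∑-support (V ⊗ W) f nz with ∑-support V _ nz
... | x , nzx with ∑-support W _ nzx
... | y , nzy = x & y , nzy

∑-only-0# : ∀ V (f : ⟦ V ⟧ → ℕ) → (∀ x → x ≢ 0# → f x ≡ 0) → ∑ V f ≡ f 0#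
∑-only-0# 𝟘 f z = refl
∑-only-0# 𝔽 f z = trans (cong (f (bit false) +_) (z (bit true) λ ())) (+-identityʳ _)
∑-only-0# (V ⊗ W) f z = trans
  (∑-only-0# V _ λ x x≢0 → ∑-zero W λ y → z (x & y) λ { refl → x≢0 refl })
  (∑-only-0# W _ λ y y≢0 → z (0# & y) λ { refl → y≢0 refl })

-- The standard pairing and indicators of subspaces.

dot : ∀ {V} → ⟦ V ⟧ → ⟦ V ⟧ → Bool
dot ∙ ∙ = false
dot (bit a) (bit b) = a ∧ b
dot (x & y) (x' & y') = dot x x' xor dot y y'

dot-⊕ʳ : ∀ {V} (p x y : ⟦ V ⟧) → dot p (x ⊕ y) ≡ dot p x xor dot p y
dot-⊕ʳ ∙ ∙ ∙ = refl
dot-⊕ʳ (bit a) (bit b) (bit c) = ∧-distribˡ-xor a b c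
dot-⊕ʳ (p & q) (x & y) (x' & y') =
  trans (cong₂ _xor_ (dot-⊕ʳ p x x') (dot-⊕ʳ q y y'))
        (xor-interchange (dot p x) (dot p x') (dot q y) (dot q y'))

dot-comm : ∀ {V} (x y : ⟦ V ⟧) → dot x y ≡ dot y x
dot-comm ∙ ∙ = refl
dot-comm (bit a) (bit b) = ∧-comm a b
dot-comm (x & y) (x' & y') = cong₂ _xor_ (dot-comm x x') (dot-comm y y')

dot-0#ʳ : ∀ {V} (p : ⟦ V ⟧) → dot p 0# ≡ false
dot-0#ʳ ∙ = refl
dot-0#ʳ (bit a) = ∧-zeroʳ a
dot-0#ʳ (p & q) = cong₂ _xor_ (dot-0#ʳ p) (dot-0#ʳ q)

dot-0#ˡ : ∀ {V} (x : ⟦ V ⟧) → dot 0# x ≡ false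
dot-0#ˡ x = trans (dot-comm 0# x) (dot-0#ʳ x)

dot-nondegenerate : ∀ {V} (p : ⟦ V ⟧) → p ≢ 0# → ∃ λ x → dot p x ≡ true
dot-nondegenerate ∙ nz = ⊥-elim (nz refl)
dot-nondegenerate (bit false) nz = ⊥-elim (nz refl)
dot-nondegenerate (bit true) nz = bit true , refl
dot-nondegenerate (p & q) nz with p ≟0#
... | no p≢0 with dot-nondegenerate p p≢0
... | x , e = x & 0# , cong₂ _xor_ e (dot-0#ʳ q)
dot-nondegenerate (p & q) nz | yes refl with dot-nondegenerate q (λ { refl → nz refl })
... | y , e = 0# & y , cong₂ _xor_ (dot-0#ʳ p) e

-- The functions 2^e · 1_S with S a subspace.
record Flat {V} (F : ⟦ V ⟧ → ℕ) : Set where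
  field
    value     : ∃ λ e → F 0# ≡ 2 ^ e
    invariant : ∀ x y → F y ≢ 0 → F (x ⊕ y) ≡ F x

  nonzero⇒value : ∀ x → F x ≢ 0 → F x ≡ F 0#
  nonzero⇒value x nz = trans (cong F (sym (⊕-identityˡ x))) (invariant 0# x nz)

  ≤value : ∀ x → F x ≤ F 0#
  ≤value x with F x ≟ 0
  ... | yes z = subst (_≤ F 0#) (sym z) z≤n
  ... | no nz = ≤-reflexive (nonzero⇒value x nz)

  closed : ∀ x y → F x ≢ 0 → F y ≢ 0 → F (x ⊕ y) ≢ 0
  closed x y nx ny e = nx (trans (sym (invariant x y ny)) e)

open Flat

*-nonzeroˡ : ∀ m {n} → m * n ≢ 0 → m ≢ 0
*-nonzeroˡ m nz refl = nz refl

*-nonzeroʳ : ∀ m {n} → m * n ≢ 0 → n ≢ 0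
*-nonzeroʳ m nz refl = nz (*-zeroʳ m)

flat-one : ∀ {V} → Flat {V} (λ _ → 1)
flat-one .value = 0 , refl
flat-one .invariant _ _ _ = refl

flat-* : ∀ {V} {F G : ⟦ V ⟧ → ℕ} → Flat F → Flat G → Flat (λ x → F x * G x)
flat-* f g .value = f .value .proj₁ + g .value .proj₁ ,
  trans (cong₂ _*_ (f .value .proj₂) (g .value .proj₂))
        (sym (^-distribˡ-+-* 2 (f .value .proj₁) (g .value .proj₁)))
flat-* {F = F} f g .invariant x y nz =
  cong₂ _*_ (f .invariant x y (*-nonzeroˡ (F y) nz)) (g .invariant x y (*-nonzeroʳ (F y) nz))

Additive : ∀ {V W} → (⟦ V ⟧ → ⟦ W ⟧) → Set
Additive φ = ∀ x y → φ (x ⊕ y) ≡ φ x ⊕ φ y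

additive-0# : ∀ {V W} {φ : ⟦ V ⟧ → ⟦ W ⟧} → Additive φ → φ 0# ≡ 0#
additive-0# {φ = φ} add = begin
  φ 0#            ≡⟨ cong φ (⊕-self 0#) ⟨
  φ (0# ⊕ 0#)     ≡⟨ add 0# 0# ⟩
  φ 0# ⊕ φ 0#     ≡⟨ ⊕-self (φ 0#) ⟩
  0#              ∎
  where open ≡-Reasoning

flat-∘ : ∀ {V W} {φ : ⟦ V ⟧ → ⟦ W ⟧} {F : ⟦ W ⟧ → ℕ} → Additive φ → Flat F → Flat (F ∘ φ)
flat-∘ {F = F} add f .value = f .value .proj₁ , trans (cong F (additive-0# add)) (f .value .proj₂)
flat-∘ {φ = φ} {F} add f .invariant x y nz =
  trans (cong F (add x y)) (f .invariant (φ x) (φ y) nz)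

∑-power : ∀ V {F : ⟦ V ⟧ → ℕ} → Flat F → ∃ λ e → ∑ V F ≡ 2 ^ e
-- If the fibre over `y` contains a point `y & b` of the support, translation by it carries the
-- fibre over `x` to that over `x ⊕ y`. The value at `0#` is itself a sum of a flat function, hence
-- the mutual recursion with `∑-power`.
flat-marginal : ∀ {V} W {F : ⟦ V ⊗ W ⟧ → ℕ} → Flat F → Flat (λ x → ∑ W λ y → F (x & y))

∑-power 𝟘 f = f .value
∑-power 𝔽 {F} f with F (bit true) ≟ 0
... | yes z = f .value .proj₁ , trans (cong₂ _+_ (f .value .proj₂) z) (+-identityʳ _)
... | no nz = suc (f .value .proj₁) ,
  cong₂ _+_ (f .value .proj₂)
        (trans (nonzero⇒value f (bit true) nz) (trans (f .value .proj₂) (sym (+-identityʳ _))))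
∑-power (V ⊗ W) f = ∑-power V (flat-marginal W f)

flat-marginal W {F} f .value = ∑-power W {λ y → F (0# & y)} (record
  { value = f .value
  ; invariant = λ x y nz → trans (cong (λ z → F (z & (x ⊕ y))) (sym (⊕-self 0#)))
                                 (f .invariant (0# & x) (0# & y) nz) })
flat-marginal W {F} f .invariant x y nz with ∑-support W _ nz
... | b , nzb = trans (sym (∑-shift W b _)) (∑-cong W λ b' → f .invariant (x & b') (y & b) nzb)

-- The indicator of the hyperplane p^⊥, or of the whole space if p = 0; products of these are the
-- indicators of the S^⊥.
χ : ∀ {V} → ⟦ V ⟧ → ⟦ V ⟧ → ℕ
χ p x = if dot p x then 0 else 1

flat-χ : ∀ {V} (p : ⟦ V ⟧) → Flat (χ p)
flat-χ p .value = 0 , cong (if_then 0 else 1) (dot-0#ʳ p)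
flat-χ p .invariant x y nz with dot p y in eq
... | true = ⊥-elim (nz refl)
... | false = cong (if_then 0 else 1)
  (trans (dot-⊕ʳ p x y) (trans (cong (dot p x xor_) eq) (xor-identityʳ _)))

-- For indicators of subspaces U' ⊆ U this is |T⁻¹U| |U'| ≤ |U| |T⁻¹U'|.
∑-modular : ∀ W X (T : ⟦ W ⟧ → ⟦ X ⟧) → Additive T → (a : ⟦ W ⟧ → ℕ) (F F' : ⟦ X ⟧ → ℕ) →
  Flat a → Flat F → Flat F' → (∀ x → F' x ≢ 0 → F x ≢ 0) →
  ∑ W (λ w → a w * F (T w)) * ∑ X F' ≤ ∑ X F * ∑ W (λ w → a w * F' (T w))
∑-modular W X T add a F F' fa fF fF' sup = begin
  ∑ W (λ w → a w * F (T w)) * ∑ X F'                        ≡⟨ ∑-*ʳ W (∑ X F') _ ⟨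
  ∑ W (λ w → a w * F (T w) * ∑ X F')                        ≡⟨ ∑-cong W (λ w → cong (a w * F (T w) *_) (∑-shift X (T w) F')) ⟨
  ∑ W (λ w → a w * F (T w) * ∑ X (λ z → F' (z ⊕ T w)))      ≡⟨ ∑-cong W (λ w → ∑-*ˡ X (a w * F (T w)) _) ⟨
  ∑ W (λ w → ∑ X (λ z → a w * F (T w) * F' (z ⊕ T w)))      ≡⟨ ∑-swap W X _ ⟩
  ∑ X (λ z → ∑ W (λ w → a w * F (T w) * F' (z ⊕ T w)))      ≤⟨ ∑-mono-≤ X fibre ⟩
  ∑ X (λ z → F z * ∑ W (λ w → a w * F' (T w)))              ≡⟨ ∑-*ʳ X _ F ⟩
  ∑ X F * ∑ W (λ w → a w * F' (T w))                        ∎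
  where
  open ≤-Reasoning
  -- Let U' ⊆ U be the supports of `F'` and `F`, and take preimages inside the support of `a`. Pairs
  -- (w, u') in T⁻¹U × U' are sorted by z = T w + u', which lies in U; a nonempty fibre is a
  -- translate of T⁻¹U' by one of its points `w₀`.
  fibre : ∀ z → ∑ W (λ w → a w * F (T w) * F' (z ⊕ T w)) ≤ F z * ∑ W (λ w → a w * F' (T w))
  fibre z with ∑ W (λ w → a w * F (T w) * F' (z ⊕ T w)) ≟ 0
  ... | yes e = subst (_≤ F z * ∑ W (λ w → a w * F' (T w))) (sym e) z≤n
  ... | no ne with ∑-support W _ ne
  ... | w₀ , nz = begin
    ∑ W (λ w → a w * F (T w) * F' (z ⊕ T w))
      ≡⟨ ∑-shift W w₀ _ ⟨
    ∑ W (λ w → a (w ⊕ w₀) * F (T (w ⊕ w₀)) * F' (z ⊕ T (w ⊕ w₀)))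
      ≤⟨ ∑-mono-≤ W term ⟩
    ∑ W (λ w → F z * (a w * F' (T w)))
      ≡⟨ ∑-*ˡ W (F z) _ ⟩
    F z * ∑ W (λ w → a w * F' (T w))
      ∎
    where
    nza : a w₀ ≢ 0
    nza = *-nonzeroˡ (a w₀) (*-nonzeroˡ (a w₀ * F (T w₀)) nz)
    nzF : F (T w₀) ≢ 0
    nzF = *-nonzeroʳ (a w₀) (*-nonzeroˡ (a w₀ * F (T w₀)) nz)
    nzF' : F' (z ⊕ T w₀) ≢ 0
    nzF' = *-nonzeroʳ (a w₀ * F (T w₀)) nz
    Fz≢0 : F z ≢ 0
    Fz≢0 e = closed fF (T w₀) (z ⊕ T w₀) nzF (sup _ nzF')
      (trans (cong F (trans (cong (T w₀ ⊕_) (⊕-comm z (T w₀))) (⊕-cancelˡ (T w₀) z))) e)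
    regroup : ∀ w → z ⊕ T (w ⊕ w₀) ≡ T w ⊕ (z ⊕ T w₀)
    regroup w = trans (cong (z ⊕_) (add w w₀)) (trans (sym (⊕-assoc z (T w) (T w₀)))
      (trans (cong (_⊕ T w₀) (⊕-comm z (T w))) (⊕-assoc (T w) z (T w₀))))
    term : ∀ w → a (w ⊕ w₀) * F (T (w ⊕ w₀)) * F' (z ⊕ T (w ⊕ w₀)) ≤ F z * (a w * F' (T w))
    term w = begin
      a (w ⊕ w₀) * F (T (w ⊕ w₀)) * F' (z ⊕ T (w ⊕ w₀))
        ≡⟨ cong₂ _*_ (cong₂ _*_ (fa .invariant w w₀ nza)
             (trans (cong F (add w w₀)) (fF .invariant (T w) (T w₀) nzF)))
             (trans (cong F' (regroup w)) (fF' .invariant (T w) (z ⊕ T w₀) nzF')) ⟩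
      a w * F (T w) * F' (T w)
        ≤⟨ *-monoˡ-≤ (F' (T w)) (*-monoʳ-≤ (a w) (≤-trans (≤value fF (T w))
             (≤-reflexive (sym (nonzero⇒value fF z Fz≢0))))) ⟩
      a w * F z * F' (T w)
        ≡⟨ cong (_* F' (T w)) (*-comm (a w) (F z)) ⟩
      F z * a w * F' (T w)
        ≡⟨ *-assoc (F z) (a w) _ ⟩
      F z * (a w * F' (T w)) ∎

-- A vector `x₀` of the support with `dot q x₀ ≡ true` translates the part off q^⊥ onto the part
-- inside it; without such a vector the part off q^⊥ is empty.
∑-halving : ∀ V {F : ⟦ V ⟧ → ℕ} → Flat F → (q : ⟦ V ⟧) →
  ∑ V F ≤ 2 * ∑ V (λ x → F x * χ q x)
∑-halving V {F} fF q = begin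
  ∑ V F                            ≡⟨ ∑-cong V split ⟩
  ∑ V (λ x → F x * χ q x + F x * χ̄ x)   ≡⟨ ∑-+ V _ _ ⟩
  ∑ V (λ x → F x * χ q x) + ∑ V (λ x → F x * χ̄ x)   ≤⟨ +-monoʳ-≤ _ other ⟩
  ∑ V (λ x → F x * χ q x) + ∑ V (λ x → F x * χ q x) ≡⟨ cong (∑ V (λ x → F x * χ q x) +_) (sym (+-identityʳ _)) ⟩
  2 * ∑ V (λ x → F x * χ q x) ∎
  where
  open ≤-Reasoning
  χ̄ : ⟦ V ⟧ → ℕ
  χ̄ x = if dot q x then 1 else 0
  split : ∀ x → F x ≡ F x * χ q x + F x * χ̄ x
  split x with dot q x
  ... | true = sym (trans (cong (_+ F x * 1) (*-zeroʳ (F x))) (*-identityʳ (F x)))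
  ... | false = sym (trans (cong₂ _+_ (*-identityʳ (F x)) (*-zeroʳ (F x))) (+-identityʳ _))
  other : ∑ V (λ x → F x * χ̄ x) ≤ ∑ V (λ x → F x * χ q x)
  other with ∑ V (λ x → F x * χ̄ x) ≟ 0
  ... | yes e = subst (_≤ ∑ V (λ x → F x * χ q x)) (sym e) z≤n
  ... | no ne with ∑-support V _ ne
  ... | x₀ , nz = ≤-reflexive (trans (sym (∑-shift V x₀ _)) (∑-cong V λ x →
      cong₂ _*_ (fF .invariant x x₀ (*-nonzeroˡ (F x₀) nz)) (flip x)))
    where
    dot≡true : dot q x₀ ≡ true
    dot≡true with dot q x₀ | *-nonzeroʳ (F x₀) nz
    ... | true | _ = refl
    ... | false | z = ⊥-elim (z refl)
    flip : ∀ x → χ̄ (x ⊕ x₀) ≡ χ q x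
    flip x rewrite dot-⊕ʳ q x x₀ | dot≡true with dot q x
    ... | true = refl
    ... | false = refl

pow : ℕ → Space → Space
pow zero V = 𝟘
pow (suc n) V = V ⊗ pow n V

dim-pow : ∀ n V → dim (pow n V) ≡ n * dim V
dim-pow zero V = refl
dim-pow (suc n) V = cong (dim V +_) (dim-pow n V)

2^-cancel-≤ : ∀ {m n} → 2 ^ m ≤ 2 ^ n → m ≤ n
2^-cancel-≤ {m} {n} le with m ≤? n
... | yes p = p
... | no ≰ = ⊥-elim (<⇒≱ (^-monoʳ-< 2 (s≤s (s≤s z≤n)) (≰⇒> ≰)) le)

n≤2^n : ∀ n → n ≤ 2 ^ n
n≤2^n zero = z≤n
n≤2^n (suc n) = ≤-trans (+-mono-≤ (m^n>0 2 n) (n≤2^n n)) (≤-reflexive (cong (2 ^ n +_) (sym (+-identityʳ _))))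

χ≤1 : ∀ {V} (p x : ⟦ V ⟧) → χ p x ≤ 1
χ≤1 p x with dot p x
... | true = z≤n
... | false = ≤-refl

χ-comm : ∀ {V} (p x : ⟦ V ⟧) → χ p x ≡ χ x p
χ-comm p x = cong (if_then 0 else 1) (dot-comm p x)

χ≡1 : ∀ {V} (p x : ⟦ V ⟧) → dot p x ≡ false → χ p x ≡ 1
χ≡1 p x e = cong (if_then 0 else 1) e

χ≢0 : ∀ {V} (p x : ⟦ V ⟧) → χ p x ≢ 0 → dot p x ≡ false
χ≢0 p x nz with dot p x
... | true = ⊥-elim (nz refl)
... | false = refl

-- Translation by `b₀` with `dot q b₀ ≡ true` toggles orthogonality, whatever `p` and `x` are.
∑-χ-balanced : ∀ X U (p x : ⟦ X ⟧) (q : ⟦ U ⟧) → q ≢ 0# → 2 * ∑ U (λ b → χ (p & q) (x & b)) ≡ 2 ^ dim U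
∑-χ-balanced X U p x q q≢0 with dot-nondegenerate q q≢0
... | b₀ , e = begin
  2 * ∑ U f                        ≡⟨ cong (∑ U f +_) (+-identityʳ _) ⟩
  ∑ U f + ∑ U f                    ≡⟨ cong (∑ U f +_) (∑-shift U b₀ f) ⟨
  ∑ U f + ∑ U (λ b → f (b ⊕ b₀))   ≡⟨ ∑-+ U f _ ⟨
  ∑ U (λ b → f b + f (b ⊕ b₀))     ≡⟨ ∑-cong U flip ⟩
  ∑ U (λ _ → 1)                    ≡⟨ ∑-const U 1 ⟩
  2 ^ dim U * 1                    ≡⟨ *-identityʳ _ ⟩
  2 ^ dim U                        ∎
  where
  open ≡-Reasoning
  f : ⟦ U ⟧ → ℕ
  f b = χ (p & q) (x & b)
  flip : ∀ b → f b + f (b ⊕ b₀) ≡ 1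
  flip b rewrite dot-⊕ʳ q b b₀ | e with dot p x | dot q b
  ... | true | true = refl
  ... | true | false = refl
  ... | false | true = refl
  ... | false | false = refl

-- Trajectories of a linear system with inputs.

module LinearSystem (X U : Space) (T : ⟦ X ⊗ U ⟧ → ⟦ X ⟧) (T-additive : Additive T)
  (T* : ⟦ X ⟧ → ⟦ X ⊗ U ⟧) (adjoint : ∀ p w → dot p (T w) ≡ dot (T* p) w) where

  -- h a k x: the number of inputs b₀, …, b_{k-1} all of whose columns (x_j, b_j), started at x₀ = x,
  -- lie in the subspace with indicator a.
  h : (⟦ X ⊗ U ⟧ → ℕ) → ℕ → ⟦ X ⟧ → ℕ
  h a zero x = 1
  h a (suc k) x = ∑ U λ b → a (x & b) * h a k (T (x & b))

  g : (⟦ X ⊗ U ⟧ → ℕ) → ℕ → ℕ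
  g a k = ∑ X (h a k)

  h-flat : ∀ {a} → Flat a → ∀ k → Flat (h a k)
  h-flat fa zero = flat-one
  h-flat fa (suc k) = flat-marginal U (flat-* fa (flat-∘ T-additive (h-flat fa k)))

  h-mono : ∀ {a a'} → (∀ w → a w ≤ a' w) → ∀ k x → h a k x ≤ h a' k x
  h-mono le zero x = ≤-refl
  h-mono le (suc k) x = ∑-mono-≤ U λ b → *-mono-≤ (le (x & b)) (h-mono le k (T (x & b)))

  -- Drop the last column. This is the inclusion of supports that `∑-modular` requires.
  h-support : ∀ a k x → h a (suc k) x ≢ 0 → h a k x ≢ 0
  h-support a zero x nz ()
  h-support a (suc k) x nz e with ∑-support U _ nz
  ... | b , nzb with m*n≡0⇒m≡0∨n≡0 (a (x & b)) (n≤0⇒n≡0 (≤-trans (∑-ub U (λ b → a (x & b) * h a k (T (x & b))) b) (≤-reflexive e)))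
  ... | inj₁ a≡0 = *-nonzeroˡ (a (x & b)) nzb a≡0
  ... | inj₂ h≡0 = h-support a k (T (x & b)) (*-nonzeroʳ (a (x & b)) nzb) h≡0

  -- Cut after `j` columns and let the second piece start anywhere: forgetting that it starts where
  -- the first one ends leaves only an inequality.
  h-+ : ∀ a j k x → h a (j + k) x ≤ h a j x * g a k
  h-+ a zero k x = ≤-trans (∑-ub X (h a k) x) (≤-reflexive (sym (+-identityʳ _)))
  h-+ a (suc j) k x = begin
    ∑ U (λ b → a (x & b) * h a (j + k) (T (x & b)))
      ≤⟨ ∑-mono-≤ U (λ b → *-monoʳ-≤ (a (x & b)) (h-+ a j k (T (x & b)))) ⟩
    ∑ U (λ b → a (x & b) * (h a j (T (x & b)) * g a k))
      ≡⟨ ∑-cong U (λ b → *-assoc (a (x & b)) _ (g a k)) ⟨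
    ∑ U (λ b → a (x & b) * h a j (T (x & b)) * g a k)
      ≡⟨ ∑-*ʳ U (g a k) _ ⟩
    h a (suc j) x * g a k ∎
    where open ≤-Reasoning

  module _ {a : ⟦ X ⊗ U ⟧ → ℕ} (fa : Flat a) where

    g-power : ∀ k → ∃ λ d → g a k ≡ 2 ^ d
    g-power k = ∑-power X (h-flat fa k)

    d : ℕ → ℕ
    d k = g-power k .proj₁

    g≡2^d : ∀ k → g a k ≡ 2 ^ d k
    g≡2^d k = g-power k .proj₂

    d-subadditive : ∀ j k → d (j + k) ≤ d j + d k
    d-subadditive j k = 2^-cancel-≤ (begin
      2 ^ d (j + k)           ≡⟨ g≡2^d (j + k) ⟨
      g a (j + k)             ≤⟨ ∑-mono-≤ X (h-+ a j k) ⟩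
      ∑ X (λ x → h a j x * g a k)  ≡⟨ ∑-*ʳ X (g a k) (h a j) ⟩
      g a j * g a k           ≡⟨ cong₂ _*_ (g≡2^d j) (g≡2^d k) ⟩
      2 ^ d j * 2 ^ d k       ≡⟨ ^-distribˡ-+-* 2 (d j) (d k) ⟨
      2 ^ (d j + d k)         ∎)
      where open ≤-Reasoning

    d-convex : ∀ k → d (suc k) + d (suc k) ≤ d k + d (suc (suc k))
    d-convex k = 2^-cancel-≤ (begin
      2 ^ (d (suc k) + d (suc k))      ≡⟨ ^-distribˡ-+-* 2 (d (suc k)) (d (suc k)) ⟩
      2 ^ d (suc k) * 2 ^ d (suc k)    ≡⟨ cong₂ _*_ (g≡2^d (suc k)) (g≡2^d (suc k)) ⟨
      -- With `w` as first column, the sums of `a w * h a k (T w)` and `a w * h a (suc k) (T w)` are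
      -- by definition `g a (suc k)` and `g a (suc (suc k))`.
      g a (suc k) * g a (suc k)        ≤⟨ ∑-modular (X ⊗ U) X T T-additive a (h a k) (h a (suc k))
                                            fa (h-flat fa k) (h-flat fa (suc k)) (h-support a k) ⟩
      g a k * g a (suc (suc k))        ≡⟨ cong₂ _*_ (g≡2^d k) (g≡2^d (suc (suc k))) ⟩
      2 ^ d k * 2 ^ d (suc (suc k))    ≡⟨ ^-distribˡ-+-* 2 (d k) (d (suc (suc k))) ⟨
      2 ^ (d k + d (suc (suc k)))      ∎)
      where open ≤-Reasoning

    d-0 : d 0 ≡ dim X
    d-0 = ≤-antisym (2^-cancel-≤ (≤-reflexive e)) (2^-cancel-≤ (≤-reflexive (sym e)))
      where e : 2 ^ d 0 ≡ 2 ^ dim X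
            e = trans (sym (g≡2^d 0)) (trans (∑-const X 1) (*-identityʳ _))

  -- h a k = O(2^{(dim U - 1) k}), written without subtraction.
  Small : (⟦ X ⊗ U ⟧ → ℕ) → Set
  Small a = ∃ λ C → ∀ k x → 2 ^ k * h a k x ≤ C * 2 ^ (k * dim U)

  small-mono : ∀ {a a'} → (∀ w → a w ≤ a' w) → Small a' → Small a
  small-mono le (C , bd) = C , λ k x → ≤-trans (*-monoʳ-≤ (2 ^ k) (h-mono le k x)) (bd k x)

  -- `dim X` is `d 0`, so the shift lands in the affine range and `g a` becomes one geometric
  -- sequence; `Small` keeps its rate below `dim U`.
  exp-g : ∀ {a} → Flat a → Small a → Exp (dim U) (λ k → ℤ.+ g a (k + dim X))
  exp-g {a} fa (C , bd) = exp-cong (λ k → sym (formula-g k))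
    (exp-geometric (dim U) rate (rate<m (dim U) (C + dim X) growth) (2^ d fa (d fa 0)))
    where
    open ConvexSubadditive (d fa) (d-subadditive fa) (d-convex fa)
    growth : ∀ k → k + d fa k ≤ C + dim X + k * dim U
    growth k = 2^-cancel-≤ (begin
      2 ^ (k + d fa k)                       ≡⟨ ^-distribˡ-+-* 2 k (d fa k) ⟩
      2 ^ k * 2 ^ d fa k                     ≡⟨ cong (2 ^ k *_) (g≡2^d fa k) ⟨
      2 ^ k * g a k                          ≡⟨ ∑-*ˡ X (2 ^ k) (h a k) ⟨
      ∑ X (λ x → 2 ^ k * h a k x)            ≤⟨ ∑-mono-≤ X (bd k) ⟩
      ∑ X (λ _ → C * 2 ^ (k * dim U))        ≡⟨ ∑-const X _ ⟩
      2 ^ dim X * (C * 2 ^ (k * dim U))      ≤⟨ *-monoʳ-≤ (2 ^ dim X) (*-monoˡ-≤ (2 ^ (k * dim U)) (n≤2^n C)) ⟩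
      2 ^ dim X * (2 ^ C * 2 ^ (k * dim U))  ≡⟨ lemma (2 ^ dim X) (2 ^ C) _ ⟩
      2 ^ C * 2 ^ dim X * 2 ^ (k * dim U)    ≡⟨ cong (_* 2 ^ (k * dim U)) (^-distribˡ-+-* 2 C (dim X)) ⟨
      2 ^ (C + dim X) * 2 ^ (k * dim U)      ≡⟨ ^-distribˡ-+-* 2 (C + dim X) (k * dim U) ⟨
      2 ^ (C + dim X + k * dim U)            ∎)
      where
      open ≤-Reasoning
      lemma : ∀ x y z → x * (y * z) ≡ y * x * z
      lemma = solve-∀
    formula-g : ∀ k → ℤ.+ g a (k + dim X) ≡ 2^ d fa (d fa 0) ℤ.* 2^ (k * rate)
    formula-g k = begin
      ℤ.+ g a (k + dim X)                     ≡⟨ cong (λ n → ℤ.+ g a (k + n)) (d-0 fa) ⟨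
      ℤ.+ g a (k + d fa 0)                    ≡⟨ cong ℤ.+_ (g≡2^d fa (k + d fa 0)) ⟩
      2^ d fa (k + d fa 0)                    ≡⟨ cong 2^_ (trans (affine k) (+-comm (k * rate) _)) ⟩
      2^ (d fa (d fa 0) + k * rate)           ≡⟨ 2^-+ (d fa (d fa 0)) (k * rate) ⟩
      2^ d fa (d fa 0) ℤ.* 2^ (k * rate)      ∎
      where open ≡-Reasoning

  -- Controllability of the system, dually: delaying a functional that does not see the input
  -- eventually produces one that does.
  data Reaches : ⟦ X ⊗ U ⟧ → Set where
    now   : ∀ {p q} → q ≢ 0# → Reaches (p & q)
    delay : ∀ {p} → Reaches (T* p) → Reaches (p & 0#)

  -- By `adjoint`, a column lies in (p, 0)^⊥ exactly when its predecessor lies in (T* p)^⊥. So the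
  -- first `k` of the `suc k` columns satisfy the condition for `T* p`, and the last input
  -- contributes at most a factor `2 ^ dim U`.
  h-delay : ∀ p k x → h (χ (p & 0#)) (suc k) x ≤ 2 ^ dim U * h (χ (T* p)) k x
  h-delay p zero x = ≤-trans
    (∑-mono-≤ U {g = λ _ → 1} λ b → ≤-trans (≤-reflexive (*-identityʳ _)) (χ≤1 (p & 0#) (x & b)))
    (≤-reflexive (∑-const U 1))
  h-delay p (suc k) x = begin
    ∑ U (λ b → χ (p & 0#) (x & b) * h (χ (p & 0#)) (suc k) (T (x & b)))
      ≤⟨ ∑-mono-≤ U term ⟩
    ∑ U (λ b → 2 ^ dim U * (χ (T* p) (x & b) * h (χ (T* p)) k (T (x & b))))
      ≡⟨ ∑-*ˡ U (2 ^ dim U) _ ⟩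
    2 ^ dim U * h (χ (T* p)) (suc k) x ∎
    where
    open ≤-Reasoning
    term : ∀ b → χ (p & 0#) (x & b) * h (χ (p & 0#)) (suc k) (T (x & b)) ≤
                 2 ^ dim U * (χ (T* p) (x & b) * h (χ (T* p)) k (T (x & b)))
    term b with h (χ (p & 0#)) (suc k) (T (x & b)) ≟ 0
    ... | yes e = subst (_≤ 2 ^ dim U * (χ (T* p) (x & b) * h (χ (T* p)) k (T (x & b))))
                        (sym (trans (cong (χ (p & 0#) (x & b) *_) e) (*-zeroʳ (χ (p & 0#) (x & b))))) z≤n
    ... | no ne with ∑-support U _ ne
    ... | b' , nz = begin
      χ (p & 0#) (x & b) * h (χ (p & 0#)) (suc k) (T (x & b))
        ≤⟨ *-mono-≤ (χ≤1 (p & 0#) (x & b)) (h-delay p k (T (x & b))) ⟩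
      1 * (2 ^ dim U * h (χ (T* p)) k (T (x & b)))
        ≡⟨ *-identityˡ _ ⟩
      2 ^ dim U * h (χ (T* p)) k (T (x & b))
        ≡⟨ cong (2 ^ dim U *_) (*-identityˡ _) ⟨
      2 ^ dim U * (1 * h (χ (T* p)) k (T (x & b)))
        ≡⟨ cong (λ c → 2 ^ dim U * (c * h (χ (T* p)) k (T (x & b)))) (χ≡1 (T* p) (x & b) vanishes) ⟨
      2 ^ dim U * (χ (T* p) (x & b) * h (χ (T* p)) k (T (x & b))) ∎
      where
      vanishes : dot (T* p) (x & b) ≡ false
      vanishes = trans (sym (adjoint p (x & b))) (trans
        (sym (trans (cong (dot p (T (x & b)) xor_) (dot-0#ˡ b')) (xor-identityʳ _)))
        (χ≢0 (p & 0#) (T (x & b) & b') (*-nonzeroˡ (χ (p & 0#) (T (x & b) & b')) nz)))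

  small-χ : ∀ {w} → Reaches w → Small (χ w)
  small-χ (now {p} {q} q≢0) = 1 , λ k x → ≤-trans (bound k x) (≤-reflexive (sym (+-identityʳ _)))
    where
    open ≤-Reasoning
    a = χ (p & q)
    lemma : ∀ c y z → 2 * c * (y * z) ≡ 2 * y * (c * z)
    lemma = solve-∀
    bound : ∀ k x → 2 ^ k * h a k x ≤ 2 ^ (k * dim U)
    bound zero x = ≤-refl
    bound (suc k) x = begin
      2 * 2 ^ k * ∑ U (λ b → a (x & b) * h a k (T (x & b)))
        ≡⟨ ∑-*ˡ U (2 * 2 ^ k) _ ⟨
      ∑ U (λ b → 2 * 2 ^ k * (a (x & b) * h a k (T (x & b))))
        ≡⟨ ∑-cong U (λ b → lemma (2 ^ k) (a (x & b)) _) ⟩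
      ∑ U (λ b → 2 * a (x & b) * (2 ^ k * h a k (T (x & b))))
        ≤⟨ ∑-mono-≤ U (λ b → *-monoʳ-≤ (2 * a (x & b)) (bound k (T (x & b)))) ⟩
      ∑ U (λ b → 2 * a (x & b) * 2 ^ (k * dim U))
        ≡⟨ ∑-*ʳ U _ _ ⟩
      ∑ U (λ b → 2 * a (x & b)) * 2 ^ (k * dim U)
        ≡⟨ cong (_* 2 ^ (k * dim U)) (trans (∑-*ˡ U 2 _) (∑-χ-balanced X U p x q q≢0)) ⟩
      2 ^ dim U * 2 ^ (k * dim U)
        ≡⟨ ^-distribˡ-+-* 2 (dim U) (k * dim U) ⟨
      2 ^ (suc k * dim U) ∎
  small-χ (delay {p} r) with small-χ r
  -- The doubling pays for the one step lost in `h-delay`; the `suc` makes the bound hold at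
  -- `k = 0`.
  ... | C , bd = suc (2 * C) , bound
    where
    open ≤-Reasoning
    lemma : ∀ c y z → 2 * c * (y * z) ≡ 2 * y * (c * z)
    lemma = solve-∀
    bound : ∀ k x → 2 ^ k * h (χ (p & 0#)) k x ≤ suc (2 * C) * 2 ^ (k * dim U)
    bound zero x = s≤s z≤n
    bound (suc k) x = begin
      2 * 2 ^ k * h (χ (p & 0#)) (suc k) x            ≤⟨ *-monoʳ-≤ (2 * 2 ^ k) (h-delay p k x) ⟩
      2 * 2 ^ k * (2 ^ dim U * h (χ (T* p)) k x)      ≡⟨ lemma (2 ^ k) (2 ^ dim U) _ ⟩
      2 * 2 ^ dim U * (2 ^ k * h (χ (T* p)) k x)      ≤⟨ *-monoʳ-≤ (2 * 2 ^ dim U) (bd k x) ⟩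
      2 * 2 ^ dim U * (C * 2 ^ (k * dim U))           ≡⟨ lemma (2 ^ dim U) C _ ⟩
      2 * C * (2 ^ dim U * 2 ^ (k * dim U))           ≡⟨ cong (2 * C *_) (^-distribˡ-+-* 2 (dim U) (k * dim U)) ⟨
      2 * C * 2 ^ (suc k * dim U)                     ≤⟨ *-monoˡ-≤ (2 ^ (suc k * dim U)) (n≤1+n (2 * C)) ⟩
      suc (2 * C) * 2 ^ (suc k * dim U)               ∎

  weight : (⟦ X ⊗ U ⟧ → ℕ) → ∀ k → ⟦ X ⟧ → ⟦ pow k U ⟧ → ℕ
  weight a zero x bs = 1
  weight a (suc k) x (b & bs) = a (x & b) * weight a k (T (x & b)) bs

  ∑-weight : ∀ a k x → ∑ (pow k U) (weight a k x) ≡ h a k x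
  ∑-weight a zero x = refl
  ∑-weight a (suc k) x = ∑-cong U λ b →
    trans (∑-*ˡ (pow k U) (a (x & b)) _) (cong (a (x & b) *_) (∑-weight a k (T (x & b))))

  weight-one : ∀ k x bs → weight (λ _ → 1) k x bs ≡ 1
  weight-one zero x bs = refl
  weight-one (suc k) x (b & bs) = trans (*-identityˡ _) (weight-one k (T (x & b)) bs)

  weight-* : ∀ a a' k x bs → weight (λ w → a w * a' w) k x bs ≡ weight a k x bs * weight a' k x bs
  weight-* a a' zero x bs = refl
  weight-* a a' (suc k) x (b & bs) =
    trans (cong (a (x & b) * a' (x & b) *_) (weight-* a a' k (T (x & b)) bs))
          (lemma (a (x & b)) (a' (x & b)) _ _)
    where lemma : ∀ x y z w → x * y * (z * w) ≡ x * z * (y * w)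
          lemma = solve-∀

  weight-χ≤1 : ∀ p k x bs → weight (χ p) k x bs ≤ 1
  weight-χ≤1 p zero x bs = ≤-refl
  weight-χ≤1 p (suc k) x (b & bs) = *-mono-≤ (χ≤1 p (x & b)) (weight-χ≤1 p k (T (x & b)) bs)

  -- If `L` contains exactly the nonzero vectors, this is the indicator of full row rank.
  avoids : List ⟦ X ⊗ U ⟧ → ∀ k → ⟦ X ⟧ → ⟦ pow k U ⟧ → ℕ
  avoids [] k x bs = 1
  avoids (p ∷ L) k x bs = (1 ∸ weight (χ p) k x bs) * avoids L k x bs

  count : (⟦ X ⊗ U ⟧ → ℕ) → List ⟦ X ⊗ U ⟧ → ℕ → ℕ
  count a L k = ∑ X λ x → ∑ (pow k U) λ bs → weight a k x bs * avoids L k x bs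

  count-[] : ∀ a k → count a [] k ≡ g a k
  count-[] a k = ∑-cong X λ x → trans (∑-cong (pow k U) λ bs → *-identityʳ _) (∑-weight a k x)

  -- One step of inclusion-exclusion: the trajectories that do not avoid `p` have all columns in
  -- p^⊥, and this condition is absorbed into `a`. If `a` indicates a subspace, so does its product
  -- with `χ p`.
  count-∷ : ∀ a p L k → count a (p ∷ L) k + count (λ w → χ p w * a w) L k ≡ count a L k
  count-∷ a p L k = trans (sym (∑-+ X _ _)) (∑-cong X λ x →
    trans (sym (∑-+ (pow k U) _ _)) (∑-cong (pow k U) λ bs → split x bs))
    where
    lemma : ∀ y z u v → v * (y * z) + u * v * z ≡ (y + u) * (v * z)
    lemma = solve-∀
    split : ∀ x bs → weight a k x bs * ((1 ∸ weight (χ p) k x bs) * avoids L k x bs) +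
                     weight (λ w → χ p w * a w) k x bs * avoids L k x bs ≡
                     weight a k x bs * avoids L k x bs
    split x bs = begin
      v * ((1 ∸ u) * z) + weight (λ w → χ p w * a w) k x bs * z
        ≡⟨ cong (λ t → v * ((1 ∸ u) * z) + t * z) (weight-* (χ p) a k x bs) ⟩
      v * ((1 ∸ u) * z) + u * v * z
        ≡⟨ lemma (1 ∸ u) z u v ⟩
      (1 ∸ u + u) * (v * z)
        ≡⟨ cong (_* (v * z)) (m∸n+n≡m (weight-χ≤1 p k x bs)) ⟩
      1 * (v * z)
        ≡⟨ *-identityˡ _ ⟩
      v * z ∎
      where
      open ≡-Reasoning
      u = weight (χ p) k x bs
      v = weight a k x bs
      z = avoids L k x bs

  +count-∷ : ∀ a p L k → ℤ.+ count a L k ℤ.- ℤ.+ count (λ w → χ p w * a w) L k ≡ ℤ.+ count a (p ∷ L) k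
  +count-∷ a p L k = trans
    (cong (λ n → ℤ.+ n ℤ.- ℤ.+ count (λ w → χ p w * a w) L k) (sym (count-∷ a p L k)))
    (lemma (ℤ.+ count a (p ∷ L) k) (ℤ.+ count (λ w → χ p w * a w) L k))
    where lemma : ∀ x y → x ℤ.+ y ℤ.- y ≡ x
          lemma = ℤSolver.solve-∀

  exp-count : ∀ L {a} → Flat a → Small a → Exp (dim U) (λ k → ℤ.+ count a L (k + dim X))
  exp-count [] {a} fa sa = exp-cong (λ k → cong ℤ.+_ (sym (count-[] a (k + dim X)))) (exp-g fa sa)
  exp-count (p ∷ L) {a} fa sa = exp-cong (λ k → +count-∷ a p L (k + dim X))
    (exp-- (exp-count L fa sa) (exp-count L (flat-* (flat-χ p) fa)
      (small-mono (λ w → ≤-trans (*-monoˡ-≤ (a w) (χ≤1 p w)) (≤-reflexive (*-identityˡ _))) sa)))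

  total : ℕ → ℤ.ℤ
  total k = 2^ (dim X + dim X * dim U) ℤ.* 2^ (k * dim U)

  count-one-[] : ∀ k → ℤ.+ count (λ _ → 1) [] (k + dim X) ≡ total k
  count-one-[] k = begin
    ℤ.+ count (λ _ → 1) [] (k + dim X)
      ≡⟨ cong ℤ.+_ (trans (∑-cong X λ x → trans
           (∑-cong (pow (k + dim X) U) λ bs → trans (*-identityʳ _) (weight-one (k + dim X) x bs))
           (trans (∑-const (pow (k + dim X) U) 1) (trans (*-identityʳ _) (cong (2 ^_) (dim-pow (k + dim X) U)))))
           (trans (∑-const X _) (sym (^-distribˡ-+-* 2 (dim X) _)))) ⟩
    2^ (dim X + (k + dim X) * dim U)
      ≡⟨ cong 2^_ (lemma (dim X) k (dim U)) ⟩
    2^ (dim X + dim X * dim U + k * dim U)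
      ≡⟨ 2^-+ (dim X + dim X * dim U) (k * dim U) ⟩
    total k ∎
    where
    open ≡-Reasoning
    lemma : ∀ x k u → x + (k + x) * u ≡ x + x * u + k * u
    lemma = solve-∀

  module _ (controllable : ∀ w → w ≢ 0# → Reaches w) where

    -- The constant weight 1 is not `Small`; it accounts for the leading term, subtracted as
    -- `total`. Every other term of the expansion contains a factor `χ p` with `p ≢ 0#` and is
    -- covered by `exp-count`.
    exp-count-one : ∀ {L} → All (_≢ 0#) L →
      Exp (dim U) (λ k → ℤ.+ count (λ _ → 1) L (k + dim X) ℤ.- total k)
    exp-count-one [] = exp-cong
      (λ k → sym (trans (cong (ℤ._- total k) (count-one-[] k)) (ℤ.+-inverseʳ (total k)))) (exp-zero (dim U))
    exp-count-one {p ∷ L} (p≢0 ∷ nz) = exp-cong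
      (λ k → trans (lemma (ℤ.+ count (λ _ → 1) L (k + dim X)) (total k)
                          (ℤ.+ count (λ w → χ p w * 1) L (k + dim X)))
                   (cong (ℤ._- total k) (+count-∷ (λ _ → 1) p L (k + dim X))))
      (exp-- (exp-count-one nz) (exp-count L (flat-* (flat-χ p) flat-one)
        (small-mono (λ w → ≤-reflexive (*-identityʳ _)) (small-χ (controllable p p≢0)))))
      where lemma : ∀ x y z → (x ℤ.- y) ℤ.- z ≡ (x ℤ.- z) ℤ.- y
            lemma = ℤSolver.solve-∀

  -- Here the trajectory is fixed and the functional varies: each of the `k` columns is one linear
  -- condition on `w`, at worst halving the support of `F`.
  ∑-kernel : ∀ {F} → Flat F → ∀ k x bs →
    ∑ (X ⊗ U) F ≤ 2 ^ k * ∑ (X ⊗ U) (λ w → F w * weight (χ w) k x bs)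
  ∑-kernel {F} fF zero x bs = ≤-reflexive (sym (trans (+-identityʳ _) (∑-cong (X ⊗ U) λ w → *-identityʳ (F w))))
  ∑-kernel {F} fF (suc k) x (b & bs) = begin
    ∑ (X ⊗ U) F
      ≤⟨ ∑-halving (X ⊗ U) fF (x & b) ⟩
    2 * ∑ (X ⊗ U) (λ w → F w * χ (x & b) w)
      ≤⟨ *-monoʳ-≤ 2 (∑-kernel (flat-* fF (flat-χ (x & b))) k (T (x & b)) bs) ⟩
    2 * (2 ^ k * ∑ (X ⊗ U) (λ w → F w * χ (x & b) w * weight (χ w) k (T (x & b)) bs))
      ≡⟨ *-assoc 2 (2 ^ k) _ ⟨
    2 ^ suc k * ∑ (X ⊗ U) (λ w → F w * χ (x & b) w * weight (χ w) k (T (x & b)) bs)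
      ≡⟨ cong (2 ^ suc k *_) (∑-cong (X ⊗ U) λ w → trans
           (*-assoc (F w) (χ (x & b) w) _) (cong (λ c → F w * (c * weight (χ w) k (T (x & b)) bs)) (χ-comm (x & b) w))) ⟩
    2 ^ suc k * ∑ (X ⊗ U) (λ w → F w * (χ w (x & b) * weight (χ w) k (T (x & b)) bs)) ∎
    where open ≤-Reasoning

  avoids-∈ : ∀ {L k x bs w} → avoids L k x bs ≢ 0 → w ∈ L → weight (χ w) k x bs ≡ 0
  avoids-∈ {p ∷ L} {k} {x} {bs} nz (there w∈L) = avoids-∈ (*-nonzeroʳ (1 ∸ weight (χ p) k x bs) nz) w∈L
  avoids-∈ {p ∷ L} {k} {x} {bs} nz (here refl)
    with weight (χ p) k x bs | *-nonzeroˡ (1 ∸ weight (χ p) k x bs) nz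
  ... | zero | _ = refl
  ... | suc n | e = ⊥-elim (e (0∸n≡0 n))

  -- By `∑-kernel` with `F = 1`, if only `0#` were orthogonal to all columns, then 2^δ ≤ 2^k would
  -- follow for δ = dim X + dim U.
  avoids-none : ∀ {L} → (∀ w → w ≢ 0# → w ∈ L) → ∀ k x bs → k < dim X + dim U → avoids L k x bs ≡ 0
  avoids-none {L} complete k x bs k<δ with avoids L k x bs ≟ 0
  ... | yes e = e
  ... | no ne = ⊥-elim (<⇒≱ k<δ (2^-cancel-≤ (begin
    2 ^ (dim X + dim U)
      ≡⟨ *-identityʳ _ ⟨
    2 ^ (dim X + dim U) * 1
      ≡⟨ ∑-const (X ⊗ U) 1 ⟨
    ∑ (X ⊗ U) (λ _ → 1)
      ≤⟨ ∑-kernel flat-one k x bs ⟩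
    2 ^ k * ∑ (X ⊗ U) (λ w → 1 * weight (χ w) k x bs)
      ≡⟨ cong (2 ^ k *_) (∑-only-0# (X ⊗ U) _ λ w w≢0 → trans (*-identityˡ _) (avoids-∈ ne (complete w w≢0))) ⟩
    2 ^ k * (1 * weight (χ 0#) k x bs)
      ≤⟨ *-monoʳ-≤ (2 ^ k) (≤-trans (≤-reflexive (*-identityˡ _)) (weight-χ≤1 0# k x bs)) ⟩
    2 ^ k * 1
      ≡⟨ *-identityʳ _ ⟩
    2 ^ k ∎)))
    where open ≤-Reasoning

  count-avoiding : (∀ w → w ≢ 0# → Reaches w) →
    ∀ {L} → All (_≢ 0#) L → (∀ w → w ≢ 0# → w ∈ L) → ∀ k →
    ℤ.+ count (λ _ → 1) L (k + dim X) ≡ 2^ (dim X + dim X * dim U) ℤ.* falling (dim U) k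
  count-avoiding controllable {L} nz complete = exp-determined (dim U) (2^ (dim X + dim X * dim U)) _ (exp-count-one controllable nz) λ k k<m →
    cong ℤ.+_ (∑-zero X λ x → ∑-zero (pow (k + dim X) U) λ bs →
      trans (cong (weight (λ _ → 1) (k + dim X) x bs *_)
        (avoids-none complete (k + dim X) x bs (subst (k + dim X <_) (+-comm (dim U) (dim X)) (+-monoˡ-< (dim X) k<m))))
        (*-zeroʳ (weight (λ _ → 1) (k + dim X) x bs)))

-- Enumeration of a space.

elems : ∀ V → List ⟦ V ⟧
elems 𝟘 = ∙ ∷ []
elems 𝔽 = bit false ∷ bit true ∷ []
elems (V ⊗ W) = cartesianProductWith _&_ (elems V) (elems W)

∈-elems : ∀ {V} (x : ⟦ V ⟧) → x ∈ elems V
∈-elems ∙ = here refl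
∈-elems (bit false) = here refl
∈-elems (bit true) = there (here refl)
∈-elems (x & y) = ∈-cartesianProductWith⁺ _&_ (∈-elems x) (∈-elems y)

elems-unique : ∀ V → Unique (elems V)
elems-unique 𝟘 = [] ∷ []
elems-unique 𝔽 = ((λ ()) ∷ []) ∷ [] ∷ []
elems-unique (V ⊗ W) =
  Unique.cartesianProductWith⁺ _&_ (λ { refl → refl , refl }) (elems-unique V) (elems-unique W)

sum-elems : ∀ V (f : ⟦ V ⟧ → ℕ) → sum (map f (elems V)) ≡ ∑ V f
sum-elems 𝟘 f = +-identityʳ _
sum-elems 𝔽 f = cong (f (bit false) +_) (+-identityʳ _)
sum-elems (V ⊗ W) f = trans (product-sum (elems V))
  (trans (cong sum (map-cong (λ x → sum-elems W (λ y → f (x & y))) (elems V))) (sum-elems V _))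
  where
  product-sum : ∀ xs → sum (map f (cartesianProductWith _&_ xs (elems W))) ≡
                       sum (map (λ x → sum (map (λ y → f (x & y)) (elems W))) xs)
  product-sum [] = refl
  product-sum (x ∷ xs) = trans (cong sum (map-++ f (map (x &_) (elems W)) _))
    (trans (sum-++ (map f (map (x &_) (elems W))) _)
           (cong₂ _+_ (cong sum (sym (map-∘ (elems W)))) (product-sum xs)))

length-filter-≢0 : ∀ {A : Set} (f : A → ℕ) → (∀ x → f x ≤ 1) → ∀ xs →
  length (filter (λ x → ¬? (f x ≟ 0)) xs) ≡ sum (map f xs)
length-filter-≢0 f f≤1 [] = refl
length-filter-≢0 f f≤1 (x ∷ xs) with f x | f≤1 x
... | 0 | _ = length-filter-≢0 f f≤1 xs
... | 1 | _ = cong suc (length-filter-≢0 f f≤1 xs)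
... | suc (suc _) | s≤s ()

nonzeros : ∀ V → List ⟦ V ⟧
nonzeros V = filter (λ x → ¬? (x ≟0#)) (elems V)

-- Banks of shift registers and their controllability.

Reg : ℕ → Space
Reg t = pow t 𝔽

snoc : ∀ t → ⟦ Reg t ⟧ → ⟦ 𝔽 ⟧ → ⟦ Reg (suc t) ⟧
snoc zero ∙ b = b & ∙
snoc (suc t) (y & ys) b = y & snoc t ys b

tl : ∀ {V W} → ⟦ V ⊗ W ⟧ → ⟦ W ⟧
tl (y & ys) = ys

initial : ∀ t → ⟦ Reg (suc t) ⟧ → ⟦ Reg t ⟧
initial zero _ = ∙
initial (suc t) (y & ys) = y & initial t ys

final : ∀ t → ⟦ Reg (suc t) ⟧ → ⟦ 𝔽 ⟧
final zero (y & ∙) = y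
final (suc t) (y & ys) = final t ys

snoc-initial-final : ∀ t z → snoc t (initial t z) (final t z) ≡ z
snoc-initial-final zero (y & ∙) = refl
snoc-initial-final (suc t) (y & ys) = cong (y &_) (snoc-initial-final t ys)

snoc-0# : ∀ t → snoc t 0# 0# ≡ 0#
snoc-0# zero = refl
snoc-0# (suc t) = cong (0# &_) (snoc-0# t)

snoc-0#⁻¹ : ∀ t x b → snoc t x b ≡ 0# → x ≡ 0# × b ≡ 0#
snoc-0#⁻¹ zero ∙ b refl = refl , refl
snoc-0#⁻¹ (suc t) (y & ys) b e with snoc-0#⁻¹ t ys b (cong tl e)
... | refl , refl = cong (_& 0#) (cong hd e) , refl
  where hd : ∀ {V W} → ⟦ V ⊗ W ⟧ → ⟦ V ⟧
        hd (x & _) = x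

snoc-⊕ : ∀ t x x' b b' → snoc t (x ⊕ x') (b ⊕ b') ≡ snoc t x b ⊕ snoc t x' b'
snoc-⊕ zero ∙ ∙ b b' = refl
snoc-⊕ (suc t) (y & ys) (y' & ys') b b' = cong ((y ⊕ y') &_) (snoc-⊕ t ys ys' b b')

tl-⊕ : ∀ {V W} (x y : ⟦ V ⊗ W ⟧) → tl (x ⊕ y) ≡ tl x ⊕ tl y
tl-⊕ (x & y) (x' & y') = refl

dot-snoc : ∀ t q x b → dot q (snoc t x b) ≡ dot (initial t q) x xor dot (final t q) b
dot-snoc zero (q & ∙) ∙ b = xor-identityʳ _
dot-snoc (suc t) (q & qs) (y & ys) b =
  trans (cong (dot q y xor_) (dot-snoc t qs ys b)) (sym (xor-assoc (dot q y) _ _))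

-- A block with t + 1 rows is a shift register of length t with one input bit:
-- the state at time j consists of the first t entries of column j, the input is its last entry.
St In : List ℕ → Space
St [] = 𝟘
St (t ∷ ts) = Reg t ⊗ St ts
In [] = 𝟘
In (t ∷ ts) = 𝔽 ⊗ In ts

dim-St : ∀ ts → dim (St ts) ≡ sum ts
dim-St [] = refl
dim-St (t ∷ ts) = cong₂ _+_ (trans (dim-pow t 𝔽) (*-identityʳ t)) (dim-St ts)

dim-In : ∀ ts → dim (In ts) ≡ length ts
dim-In [] = refl
dim-In (t ∷ ts) = cong suc (dim-In ts)

-- In a Hankel block each column is the previous one moved up by one row with a new last entry. For
-- `t = 0` nothing is stored and the input is forgotten.
step : ∀ ts → ⟦ St ts ⊗ In ts ⟧ → ⟦ St ts ⟧
step [] _ = ∙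
step (t ∷ ts) ((x & xs) & (b & bs)) = tl (snoc t x b) & step ts (xs & bs)

step-additive : ∀ ts → Additive (step ts)
step-additive [] _ _ = refl
step-additive (t ∷ ts) ((x & xs) & (b & bs)) ((x' & xs') & (b' & bs')) = cong₂ _&_
  (trans (cong tl (snoc-⊕ t x x' b b')) (tl-⊕ (snoc t x b) (snoc t x' b')))
  (step-additive ts (xs & bs) (xs' & bs'))

-- `0# & p` extends `p` to a whole column by ignoring the oldest entry, the adjoint of `tl`;
-- `initial` and `final` extract its parts on the state and on the input.
delayX : ∀ ts → ⟦ St ts ⟧ → ⟦ St ts ⟧
delayX [] ∙ = ∙
delayX (t ∷ ts) (p & ps) = initial t (0# & p) & delayX ts ps

delayU : ∀ ts → ⟦ St ts ⟧ → ⟦ In ts ⟧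
delayU [] ∙ = ∙
delayU (t ∷ ts) (p & ps) = final t (0# & p) & delayU ts ps

delayed : ∀ ts → ⟦ St ts ⟧ → ⟦ St ts ⊗ In ts ⟧
delayed ts p = delayX ts p & delayU ts p

step-adjoint : ∀ ts p w → dot p (step ts w) ≡ dot (delayed ts p) w
step-adjoint [] ∙ (∙ & ∙) = refl
step-adjoint (t ∷ ts) (p & ps) ((x & xs) & (b & bs)) = trans
  (cong₂ _xor_ (trans (dot-tl (snoc t x b)) (dot-snoc t (0# & p) x b)) (step-adjoint ts ps (xs & bs)))
  (xor-interchange (dot (initial t (0# & p)) x) (dot (final t (0# & p)) b) (dot (delayX ts ps) xs) _)
  where dot-tl : ∀ z → dot p (tl z) ≡ dot (0# & p) z
        dot-tl (bit _ & _) = refl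

delay-injective : ∀ ts p → delayX ts p ≡ 0# → delayU ts p ≡ 0# → p ≡ 0#
delay-injective [] ∙ _ _ = refl
delay-injective (t ∷ ts) (p & ps) ex eu with initial t (0# & p) in e₁ | delayX ts ps in e₂ | final t (0# & p) in e₃ | delayU ts ps in e₄
delay-injective (t ∷ ts) (p & ps) refl refl | _ | _ | _ | _ = cong₂ _&_
  (cong tl (trans (sym (snoc-initial-final t (0# & p))) (trans (cong₂ (snoc t) e₁ e₃) (snoc-0# t))))
  (delay-injective ts ps e₂ e₄)

-- Every delay prepends a zero to each register, so before sum ts delays a nonzero functional
-- must have reached an input.
Leading0 : ℕ → ∀ t → ⟦ Reg t ⟧ → Set
Leading0 zero t x = ⊤
Leading0 (suc n) zero x = ⊤
Leading0 (suc n) (suc t) (y & ys) = y ≡ 0# × Leading0 n t ys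

-- `c` is a variable because in the recursion the head `y` of the register takes the place of the
-- prepended zero.
leading0-initial : ∀ n t c p → c ≡ 0# → Leading0 n t p → Leading0 (suc n) t (initial t (c & p))
leading0-initial n zero c p _ _ = tt
leading0-initial zero (suc t) c p e _ = e , tt
leading0-initial (suc n) (suc t) c (y & ys) e (e' , l) = e , leading0-initial n t y ys e' l

leading0-all : ∀ n t p → t ≤ n → Leading0 n t p → p ≡ 0#
leading0-all n zero ∙ _ _ = refl
leading0-all (suc n) (suc t) (y & ys) (s≤s t≤n) (refl , l) = cong (0# &_) (leading0-all n t ys t≤n l)

Leading0s : ℕ → ∀ ts → ⟦ St ts ⟧ → Set
Leading0s n [] _ = ⊤
Leading0s n (t ∷ ts) (p & ps) = Leading0 n t p × Leading0s n ts ps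

leading0s-zero : ∀ ts p → Leading0s 0 ts p
leading0s-zero [] ∙ = tt
leading0s-zero (t ∷ ts) (p & ps) = tt , leading0s-zero ts ps

leading0s-delay : ∀ n ts p → Leading0s n ts p → Leading0s (suc n) ts (delayX ts p)
leading0s-delay n [] ∙ _ = tt
leading0s-delay n (t ∷ ts) (p & ps) (l , ls) = leading0-initial n t 0# p refl l , leading0s-delay n ts ps ls

leading0s-all : ∀ n ts p → sum ts ≤ n → Leading0s n ts p → p ≡ 0#
leading0s-all n [] ∙ _ _ = refl
leading0s-all n (t ∷ ts) (p & ps) le (l , ls) = cong₂ _&_
  (leading0-all n t p (≤-trans (m≤m+n t (sum ts)) le) l)
  (leading0s-all n ts ps (≤-trans (m≤n+m (sum ts) t) le) ls)

module Stacked (ts : List ℕ) where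
  open LinearSystem (St ts) (In ts) (step ts) (step-additive ts) (delayed ts) (step-adjoint ts) public

  -- `n` is the number of delays made so far. While no input is reached, `delay-injective` keeps the
  -- functional nonzero; `sum ts` bounds every register length, so once `fuel` is spent the zeros
  -- would fill all registers.
  reaches-state : ∀ fuel n p → sum ts ≤ fuel + n → Leading0s n ts p → p ≢ 0# → Reaches (p & 0#)
  reaches-state zero n p le l p≢0 = ⊥-elim (p≢0 (leading0s-all n ts p le l))
  reaches-state (suc fuel) n p le l p≢0 with delayU ts p ≟0#
  ... | no ne = delay (now ne)
  ... | yes e = delay (subst (λ q → Reaches (delayX ts p & q)) (sym e)
    (reaches-state fuel (suc n) (delayX ts p) (subst (sum ts ≤_) (sym (+-suc fuel n)) le)
      (leading0s-delay n ts p l) λ e' → p≢0 (delay-injective ts p e' e)))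

  controllable : ∀ w → w ≢ 0# → Reaches w
  controllable (p & q) w≢0 with q ≟0#
  ... | no q≢0 = now q≢0
  ... | yes refl = reaches-state (sum ts) 0 p (m≤m+n (sum ts) 0) (leading0s-zero ts p) λ { refl → w≢0 refl }

  full : ∀ k → ⟦ St ts ⊗ pow k (In ts) ⟧ → ℕ
  full k (x & bs) = avoids (nonzeros (St ts ⊗ In ts)) k x bs

  avoids≤1 : ∀ L k x bs → avoids L k x bs ≤ 1
  avoids≤1 [] k x bs = ≤-refl
  avoids≤1 (p ∷ L) k x bs = *-mono-≤ (m∸n≤m 1 (weight (χ p) k x bs)) (avoids≤1 L k x bs)

  avoids≢0 : ∀ {L} k x bs → All (λ w → weight (χ w) k x bs ≡ 0) L → avoids L k x bs ≢ 0
  avoids≢0 k x bs [] ()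
  avoids≢0 {p ∷ L} k x bs (e ∷ es) rewrite e = avoids≢0 k x bs es ∘ trans (sym (+-identityʳ _))

  ∈-nonzeros : ∀ w → w ≢ 0# → w ∈ nonzeros (St ts ⊗ In ts)
  ∈-nonzeros w w≢0 = ∈-filter⁺ (λ x → ¬? (x ≟0#)) (∈-elems w) w≢0

  fulls : ∀ k → List ⟦ St ts ⊗ pow k (In ts) ⟧
  fulls k = filter (λ u → ¬? (full k u ≟ 0)) (elems (St ts ⊗ pow k (In ts)))

  length-fulls : ∀ j → ℤ.+ length (fulls (j + sum ts)) ≡
    2^ (sum ts + sum ts * length ts) ℤ.* falling (length ts) j
  length-fulls j = begin
    ℤ.+ length (fulls k)
      ≡⟨ cong ℤ.+_ (length-filter-≢0 (full k) (λ { (x & bs) → avoids≤1 (nonzeros (St ts ⊗ In ts)) k x bs })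
           (elems (St ts ⊗ pow k (In ts)))) ⟩
    ℤ.+ sum (map (full k) (elems (St ts ⊗ pow k (In ts))))
      ≡⟨ cong ℤ.+_ (sum-elems (St ts ⊗ pow k (In ts)) (full k)) ⟩
    ℤ.+ ∑ (St ts) (λ x → ∑ (pow k (In ts)) (λ bs → full k (x & bs)))
      ≡⟨ cong ℤ.+_ (∑-cong (St ts) λ x → ∑-cong (pow k (In ts)) λ bs →
           trans (cong (_* full k (x & bs)) (weight-one k x bs)) (*-identityˡ _)) ⟨
    ℤ.+ count (λ _ → 1) (nonzeros (St ts ⊗ In ts)) k
      ≡⟨ cong (λ n → ℤ.+ count (λ _ → 1) (nonzeros (St ts ⊗ In ts)) (j + n)) (dim-St ts) ⟨
    ℤ.+ count (λ _ → 1) (nonzeros (St ts ⊗ In ts)) (j + dim (St ts))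
      ≡⟨ count-avoiding controllable (all-filter (λ x → ¬? (x ≟0#)) (elems (St ts ⊗ In ts))) ∈-nonzeros j ⟩
    2^ (dim (St ts) + dim (St ts) * dim (In ts)) ℤ.* falling (dim (In ts)) j
      ≡⟨ cong₂ (λ a b → 2^ (a + a * b) ℤ.* falling b j) (dim-St ts) (dim-In ts) ⟩
    2^ (sum ts + sum ts * length ts) ℤ.* falling (length ts) j ∎
    where
    open ≡-Reasoning
    k = j + sum ts

-- The product formula.

pos-∸ : ∀ {m n} → n ≤ m → ℤ.+ (m ∸ n) ≡ ℤ.+ m ℤ.- ℤ.+ n
pos-∸ {m} {n} n≤m = trans (sym (ℤ.⊖-≥ n≤m)) (sym (ℤ.m-n≡m⊖n m n))

-- Index `i` gives the factor 2^D (2^j - 2^{m-1-i}), so the product meets the factors of `falling`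
-- from the top. The hypothesis `m ≤ j` makes every `∸` a genuine subtraction.
product-falling : ∀ D m j → m ≤ j →
  ℤ.+ product (applyUpTo (λ i → 2 ^ (j + D) ∸ 2 ^ (m + D ∸ suc i)) m) ≡ 2^ (D * m) ℤ.* falling m j
product-falling D zero j _ = cong (λ n → 2^ n ℤ.* ℤ.1ℤ) (sym (*-zeroʳ D))
product-falling D (suc m) j m<j = begin
  ℤ.+ (a * b)
    ≡⟨ ℤ.pos-* a b ⟩
  ℤ.+ a ℤ.* ℤ.+ b
    ≡⟨ cong₂ ℤ._*_ (trans (pos-∸ (^-monoʳ-≤ 2 (+-monoˡ-≤ D m≤j))) (cong₂ ℤ._-_ (2^-+ j D) (2^-+ m D)))
                   (product-falling D m j m≤j) ⟩
  (2^ j ℤ.* 2^ D ℤ.- 2^ m ℤ.* 2^ D) ℤ.* (2^ (D * m) ℤ.* falling m j)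
    ≡⟨ lemma (2^ j) (2^ m) (2^ D) (2^ (D * m)) (falling m j) ⟩
  2^ D ℤ.* 2^ (D * m) ℤ.* falling (suc m) j
    ≡⟨ cong (ℤ._* falling (suc m) j) (2^-+ D (D * m)) ⟨
  2^ (D + D * m) ℤ.* falling (suc m) j
    ≡⟨ cong (λ n → 2^ n ℤ.* falling (suc m) j) (*-suc D m) ⟨
  2^ (D * suc m) ℤ.* falling (suc m) j ∎
  where
  open ≡-Reasoning
  m≤j = <⇒≤ m<j
  a = 2 ^ (j + D) ∸ 2 ^ (m + D)
  b = product (applyUpTo (λ i → 2 ^ (j + D) ∸ 2 ^ (m + D ∸ suc i)) m)
  lemma : ∀ x y d e f → (x ℤ.* d ℤ.- y ℤ.* d) ℤ.* (e ℤ.* f) ≡ d ℤ.* e ℤ.* ((x ℤ.- y) ℤ.* f)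
  lemma = ℤSolver.solve-∀

formula-falling : ∀ D m j → m ≤ j → ℤ.+ formula m (j + D) (m + D) ≡ 2^ (D + D * m) ℤ.* falling m j
formula-falling D m j m≤j = begin
  ℤ.+ (2 ^ (m + D ∸ m) * product (map φ (map suc (upTo m))))
    ≡⟨ cong₂ (λ e l → ℤ.+ (2 ^ e * product l)) (m+n∸m≡n m D)
         (trans (cong (map φ) (map-applyUpTo id suc m)) (map-applyUpTo suc φ m)) ⟩
  ℤ.+ (2 ^ D * product (applyUpTo (φ ∘ suc) m))
    ≡⟨ ℤ.pos-* (2 ^ D) _ ⟩
  2^ D ℤ.* ℤ.+ product (applyUpTo (φ ∘ suc) m)
    ≡⟨ cong (2^ D ℤ.*_) (product-falling D m j m≤j) ⟩
  2^ D ℤ.* (2^ (D * m) ℤ.* falling m j)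
    ≡⟨ ℤ.*-assoc (2^ D) (2^ (D * m)) (falling m j) ⟨
  2^ D ℤ.* 2^ (D * m) ℤ.* falling m j
    ≡⟨ cong (ℤ._* falling m j) (2^-+ D (D * m)) ⟨
  2^ (D + D * m) ℤ.* falling m j ∎
  where
  open ≡-Reasoning
  φ : ℕ → ℕ
  φ i = 2 ^ (j + D) ∸ 2 ^ (m + D ∸ i)

-- Parameters as initial states and inputs.

vec : ∀ {n} → ⟦ Reg n ⟧ → Vec Bool n
vec {zero} ∙ = []
vec {suc n} (bit b & x) = b ∷ vec x

unvec : ∀ {n} → Vec Bool n → ⟦ Reg n ⟧
unvec [] = ∙
unvec (b ∷ v) = bit b & unvec v

vec-unvec : ∀ {n} (v : Vec Bool n) → vec (unvec v) ≡ v
vec-unvec [] = refl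
vec-unvec (b ∷ v) = cong (b ∷_) (vec-unvec v)

unvec-vec : ∀ {n} (x : ⟦ Reg n ⟧) → unvec (vec x) ≡ x
unvec-vec {zero} ∙ = refl
unvec-vec {suc n} (bit b & x) = cong (bit b &_) (unvec-vec x)

vec-injective : ∀ {n} {x y : ⟦ Reg n ⟧} → vec x ≡ vec y → x ≡ y
vec-injective {x = x} {y} e = trans (sym (unvec-vec x)) (trans (cong unvec e) (unvec-vec y))

module _ {V W : Space} where

  firsts : ∀ k → ⟦ pow k (V ⊗ W) ⟧ → ⟦ pow k V ⟧
  firsts zero ∙ = ∙
  firsts (suc k) ((v & _) & vws) = v & firsts k vws

  seconds : ∀ k → ⟦ pow k (V ⊗ W) ⟧ → ⟦ pow k W ⟧
  seconds zero ∙ = ∙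
  seconds (suc k) ((_ & w) & vws) = w & seconds k vws

  zips : ∀ k → ⟦ pow k V ⟧ → ⟦ pow k W ⟧ → ⟦ pow k (V ⊗ W) ⟧
  zips zero ∙ ∙ = ∙
  zips (suc k) (v & vs) (w & ws) = (v & w) & zips k vs ws

  zips-firsts-seconds : ∀ k vws → zips k (firsts k vws) (seconds k vws) ≡ vws
  zips-firsts-seconds zero ∙ = refl
  zips-firsts-seconds (suc k) ((v & w) & vws) = cong ((v & w) &_) (zips-firsts-seconds k vws)

  firsts-zips : ∀ k vs ws → firsts k (zips k vs ws) ≡ vs
  firsts-zips zero ∙ ∙ = refl
  firsts-zips (suc k) (v & vs) (w & ws) = cong (v &_) (firsts-zips k vs ws)

  seconds-zips : ∀ k vs ws → seconds k (zips k vs ws) ≡ ws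
  seconds-zips zero ∙ ∙ = refl
  seconds-zips (suc k) (v & vs) (w & ws) = cong (w &_) (seconds-zips k vs ws)

-- The first `t` parameters of a block fill its register, the other `k` are its inputs. Sizes of the
-- form `suc t` make `suc t + k ∸ 1` reduce to `t + k`.
params : ∀ ts k → ⟦ St ts ⟧ → ⟦ pow k (In ts) ⟧ → Vec Bool (numParams k (map suc ts))
params [] k ∙ bs = []
params (t ∷ ts) k (x & xs) bs = (vec x Vec.++ vec (firsts k bs)) Vec.++ params ts k xs (seconds k bs)

params-injective : ∀ ts k x bs x' bs' → params ts k x bs ≡ params ts k x' bs' → x ≡ x' × bs ≡ bs'
params-injective [] k ∙ bs ∙ bs' _ = refl , trivial k bs bs'
  where trivial : ∀ k (bs bs' : ⟦ pow k 𝟘 ⟧) → bs ≡ bs'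
        trivial zero ∙ ∙ = refl
        trivial (suc k) (∙ & bs) (∙ & bs') = cong (∙ &_) (trivial k bs bs')
params-injective (t ∷ ts) k (x & xs) bs (x' & xs') bs' e
  with ++-injective (vec x Vec.++ vec (firsts k bs)) (vec x' Vec.++ vec (firsts k bs')) e
... | e₁ , e₂ with ++-injective (vec x) (vec x') e₁ | params-injective ts k xs (seconds k bs) xs' (seconds k bs') e₂
... | ex , eb | exs , ebs = cong₂ _&_ (vec-injective ex) exs ,
  trans (sym (zips-firsts-seconds k bs))
    (trans (cong₂ (zips k) (vec-injective eb) ebs) (zips-firsts-seconds k bs'))

zeros : ∀ k → ⟦ pow k 𝟘 ⟧
zeros zero = ∙
zeros (suc k) = ∙ & zeros k

params-surjective : ∀ ts k α → ∃ λ x → ∃ λ bs → params ts k x bs ≡ α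
params-surjective [] k [] = ∙ , zeros k , refl
params-surjective (t ∷ ts) k α with splitAt (t + k) α
... | β , γ , refl with splitAt t β | params-surjective ts k γ
... | ξ , η , refl | xs , bs , refl = unvec ξ & xs , zips k (unvec η) bs ,
  cong₂ Vec._++_ (cong₂ Vec._++_ (vec-unvec ξ) (trans (cong vec (firsts-zips k (unvec η) bs)) (vec-unvec η)))
                 (cong (params ts k xs) (seconds-zips k (unvec η) bs))

-- Junk value false beyond the end of the vector.
nth : ∀ {n} → Vec Bool n → ℕ → Bool
nth [] _ = false
nth (b ∷ v) zero = b
nth (b ∷ v) (suc i) = nth v i

lookup-fromℕ< : ∀ {n} (v : Vec Bool n) i (i<n : i < n) → lookup v (fromℕ< i<n) ≡ nth v i
lookup-fromℕ< (b ∷ v) zero _ = refl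
lookup-fromℕ< (b ∷ v) (suc i) i<n = lookup-fromℕ< v i (s<s⁻¹ i<n)

nth-snoc : ∀ {n} t x b (v : Vec Bool n) i → nth (vec (snoc t x (bit b)) Vec.++ v) i ≡ nth (vec x Vec.++ (b ∷ v)) i
nth-snoc zero ∙ b v i = refl
nth-snoc (suc t) (bit y & ys) b v zero = refl
nth-snoc (suc t) (bit y & ys) b v (suc i) = nth-snoc t ys b v i

nth-tl : ∀ {n} t (z : ⟦ Reg (suc t) ⟧) (v : Vec Bool n) i → nth (vec z Vec.++ v) (suc i) ≡ nth (vec (tl z) Vec.++ v) i
nth-tl t (bit y & ys) v i = refl

-- Entries of linear combinations of the rows.

pair : ∀ {n} → ⟦ Reg n ⟧ → (ℕ → Bool) → Bool
pair {zero} ∙ f = false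
pair {suc n} (bit b & q) f = (b ∧ f 0) xor pair q (f ∘ suc)

pair-cong : ∀ {n} (q : ⟦ Reg n ⟧) {f f'} → (∀ i → f i ≡ f' i) → pair q f ≡ pair q f'
pair-cong {zero} ∙ e = refl
pair-cong {suc n} (bit b & q) e = cong₂ _xor_ (cong (b ∧_) (e 0)) (pair-cong q (e ∘ suc))

pair-snoc : ∀ {n} t p q x b (v : Vec Bool n) →
  pair (snoc t p q) (nth (vec x Vec.++ (b ∷ v))) ≡ dot p x xor dot q (bit b)
pair-snoc zero ∙ (bit q) ∙ b v = xor-identityʳ _
pair-snoc (suc t) (bit p & ps) q (bit x & xs) b v =
  trans (cong ((p ∧ x) xor_) (pair-snoc t ps q xs b v)) (sym (xor-assoc (p ∧ x) _ _))

bits : ∀ {n} → ⟦ Reg n ⟧ → List Bool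
bits {zero} ∙ = []
bits {suc n} (bit b & q) = b ∷ bits q

length-bits : ∀ {n} (q : ⟦ Reg n ⟧) → length (bits q) ≡ n
length-bits {zero} ∙ = refl
length-bits {suc n} (bit b & q) = cong suc (length-bits q)

true∈bits : ∀ {n} (q : ⟦ Reg n ⟧) → q ≢ 0# → true ∈ bits q
true∈bits {zero} ∙ nz = ⊥-elim (nz refl)
true∈bits {suc n} (bit true & q) nz = here refl
true∈bits {suc n} (bit false & q) nz = there (true∈bits q λ { refl → nz refl })

true∉bits-0# : ∀ n → ¬ (true ∈ bits {n} 0#)
true∉bits-0# (suc n) (there i) = true∉bits-0# n i

split-bits : ∀ n r l → length l ≡ n + r → ∃ λ (q : ⟦ Reg n ⟧) → ∃ λ l' → l ≡ bits q ++ l' × length l' ≡ r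
split-bits zero r l e = ∙ , l , refl , e
split-bits (suc n) r (b ∷ l) e with split-bits n r l (suc-injective e)
... | q , l' , refl , e' = bit b & q , l' , refl , e'

-- In each block the input coordinate belongs to the last row, hence `snoc`.
coeffs : ∀ ts → ⟦ St ts ⟧ → ⟦ In ts ⟧ → List Bool
coeffs [] _ _ = []
coeffs (t ∷ ts) (p & ps) (q & qs) = bits (snoc t p q) ++ coeffs ts ps qs

length-coeffs : ∀ ts p q → length (coeffs ts p q) ≡ sum (map suc ts)
length-coeffs [] p q = refl
length-coeffs (t ∷ ts) (p & ps) (q & qs) = trans (length-++ (bits (snoc t p q)))
  (cong₂ _+_ (length-bits (snoc t p q)) (length-coeffs ts ps qs))

true∈coeffs : ∀ ts p q → p & q ≢ 0# → true ∈ coeffs ts p q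
true∈coeffs [] ∙ ∙ nz = ⊥-elim (nz refl)
true∈coeffs (t ∷ ts) (p & ps) (q & qs) nz with snoc t p q ≟0#
... | no ne = ∈-++⁺ˡ (true∈bits (snoc t p q) ne)
... | yes e with snoc-0#⁻¹ t p q e
... | refl , refl = ∈-++⁺ʳ (bits (snoc t 0# 0#)) (true∈coeffs ts ps qs λ { refl → nz refl })

true∉coeffs-0# : ∀ ts → ¬ (true ∈ coeffs ts 0# 0#)
true∉coeffs-0# (t ∷ ts) i with ∈-++⁻ (bits (snoc t 0# 0#)) i
... | inj₁ i' = true∉bits-0# (suc t) (subst (λ z → true ∈ bits z) (snoc-0# t) i')
... | inj₂ i' = true∉coeffs-0# ts i'

coeffs-surjective : ∀ ts l → length l ≡ sum (map suc ts) → ∃ λ p → ∃ λ q → coeffs ts p q ≡ l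
coeffs-surjective [] [] _ = ∙ , ∙ , refl
coeffs-surjective (t ∷ ts) l e with split-bits (suc t) (sum (map suc ts)) l e
... | z , l' , refl , e' with coeffs-surjective ts l' e'
... | ps , qs , refl = initial t z & ps , final t z & qs ,
  cong (λ z → bits z ++ coeffs ts ps qs) (snoc-initial-final t z)

entry : ∀ ts k → ⟦ St ts ⟧ → ⟦ In ts ⟧ → ⟦ St ts ⟧ → ⟦ pow k (In ts) ⟧ → ℕ → Bool
entry [] k _ _ _ _ j = false
entry (t ∷ ts) k (p & ps) (q & qs) (x & xs) bs j =
  pair (snoc t p q) (λ r → nth (vec x Vec.++ vec (firsts k bs)) (r + j)) xor
  entry ts k ps qs xs (seconds k bs) j

entry-zero : ∀ ts k p q x b bs → entry ts (suc k) p q x (b & bs) 0 ≡ dot (p & q) (x & b)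
entry-zero [] k ∙ ∙ ∙ ∙ bs = refl
entry-zero (t ∷ ts) k (p & ps) (q & qs) (x & xs) (bit b & b') bs = trans
  (cong₂ _xor_
    (trans (pair-cong (snoc t p q) λ r → cong (nth (vec x Vec.++ vec (firsts (suc k) ((bit b & b') & bs)))) (+-identityʳ r))
           (pair-snoc t p q x b (vec (firsts k bs))))
    (entry-zero ts k ps qs xs b' (seconds k bs)))
  (xor-interchange (dot p x) (dot q (bit b)) (dot ps xs) (dot qs b'))

-- Dropping the first parameter of each block gives the parameters of the trajectory started one
-- step later; this is where the Hankel shape enters.
entry-suc : ∀ ts k p q x b bs j →
  entry ts (suc k) p q x (b & bs) (suc j) ≡ entry ts k p q (step ts (x & b)) bs j
entry-suc [] k ∙ ∙ ∙ ∙ bs j = refl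
entry-suc (t ∷ ts) k (p & ps) (q & qs) (x & xs) (bit b & b') bs j = cong₂ _xor_
  (pair-cong (snoc t p q) λ r → begin
    nth (vec x Vec.++ (b ∷ v)) (r + suc j)               ≡⟨ cong (nth (vec x Vec.++ (b ∷ v))) (+-suc r j) ⟩
    nth (vec x Vec.++ (b ∷ v)) (suc (r + j))             ≡⟨ nth-snoc t x b v (suc (r + j)) ⟨
    nth (vec (snoc t x (bit b)) Vec.++ v) (suc (r + j))  ≡⟨ nth-tl t (snoc t x (bit b)) v (r + j) ⟩
    nth (vec (tl (snoc t x (bit b))) Vec.++ v) (r + j)   ∎)
  (entry-suc ts k ps qs xs b' (seconds k bs) j)
  where
  open ≡-Reasoning
  v = vec (firsts k bs)

-- The stacked matrix and its row rank.

lincomb-++ : ∀ {k} l₁ l₂ (r₁ r₂ : List (Row k)) j → length l₁ ≡ length r₁ →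
  lincomb (l₁ ++ l₂) (r₁ ++ r₂) j ≡ lincomb l₁ r₁ j xor lincomb l₂ r₂ j
lincomb-++ [] l₂ [] r₂ j _ = refl
lincomb-++ (c ∷ l₁) l₂ (r ∷ r₁) r₂ j e =
  trans (cong ((c ∧ r j) xor_) (lincomb-++ l₁ l₂ r₁ r₂ j (suc-injective e))) (sym (xor-assoc (c ∧ r j) _ _))

lincomb-tabulate : ∀ {k} n (q : ⟦ Reg n ⟧) (rows : Fin n → Row k) j f → (∀ r → rows r j ≡ f (toℕ r)) →
  lincomb (bits q) (tabulate rows) j ≡ pair q f
lincomb-tabulate zero ∙ rows j f e = refl
lincomb-tabulate (suc n) (bit b & q) rows j f e = cong₂ _xor_ (cong (b ∧_) (e zero))
  (lincomb-tabulate n q (rows ∘ suc) j (f ∘ suc) (e ∘ suc))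

lincomb-hankel : ∀ k s (q : ⟦ Reg s ⟧) (β : Vec Bool (s + k ∸ 1)) j →
  lincomb (bits q) (hankelRows k s β) j ≡ pair q (λ r → nth β (r + toℕ j))
lincomb-hankel k s q β j = trans
  (cong (λ rows → lincomb (bits q) rows j) (map-tabulate {n = s} id _))
  (lincomb-tabulate s q _ j _ λ r → lookup-fromℕ< β (toℕ r + toℕ j) (hankel-bound r j))

length-hankelRows : ∀ k s β → length (hankelRows k s β) ≡ s
length-hankelRows k s β = trans (length-map _ (allFin s)) (length-tabulate {n = s} id)

-- `stackedRows` sees only the decomposition that `splitAt` returns; `++-injective` identifies it
-- with `β` and `γ`.
stackedRows-++ : ∀ k s ss (β : Vec Bool (s + k ∸ 1)) γ →
  stackedRows k (s ∷ ss) (β Vec.++ γ) ≡ hankelRows k s β ++ stackedRows k ss γ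
stackedRows-++ k s ss β γ with splitAt (s + k ∸ 1) (β Vec.++ γ)
... | β' , γ' , e with ++-injective β β' e
... | refl , refl = refl

matrix : ∀ ts k → ⟦ St ts ⟧ → ⟦ pow k (In ts) ⟧ → List (Row k)
matrix ts k x bs = stackedRows k (map suc ts) (params ts k x bs)

length-matrix : ∀ ts k x bs → length (matrix ts k x bs) ≡ sum (map suc ts)
length-matrix [] k ∙ bs = refl
length-matrix (t ∷ ts) k (x & xs) bs = trans
  (cong length (stackedRows-++ k (suc t) (map suc ts) (vec x Vec.++ vec (firsts k bs)) (params ts k xs (seconds k bs))))
  (trans (length-++ (hankelRows k (suc t) (vec x Vec.++ vec (firsts k bs))))
         (cong₂ _+_ (length-hankelRows k (suc t) (vec x Vec.++ vec (firsts k bs))) (length-matrix ts k xs (seconds k bs))))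

lincomb-matrix : ∀ ts k p q x bs j → lincomb (coeffs ts p q) (matrix ts k x bs) j ≡ entry ts k p q x bs (toℕ j)
lincomb-matrix [] k p q ∙ bs j = refl
lincomb-matrix (t ∷ ts) k (p & ps) (q & qs) (x & xs) bs j = begin
  lincomb (bits (snoc t p q) ++ coeffs ts ps qs) (matrix (t ∷ ts) k (x & xs) bs) j
    ≡⟨ cong (λ rows → lincomb (bits (snoc t p q) ++ coeffs ts ps qs) rows j)
         (stackedRows-++ k (suc t) (map suc ts) β (params ts k xs (seconds k bs))) ⟩
  lincomb (bits (snoc t p q) ++ coeffs ts ps qs) (hankelRows k (suc t) β ++ matrix ts k xs (seconds k bs)) j
    ≡⟨ lincomb-++ (bits (snoc t p q)) (coeffs ts ps qs) (hankelRows k (suc t) β) _ j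
         (trans (length-bits (snoc t p q)) (sym (length-hankelRows k (suc t) β))) ⟩
  lincomb (bits (snoc t p q)) (hankelRows k (suc t) β) j xor
    lincomb (coeffs ts ps qs) (matrix ts k xs (seconds k bs)) j
    ≡⟨ cong₂ _xor_ (lincomb-hankel k (suc t) (snoc t p q) β j) (lincomb-matrix ts k ps qs xs (seconds k bs) j) ⟩
  entry (t ∷ ts) k (p & ps) (q & qs) (x & xs) bs (toℕ j) ∎
  where
  open ≡-Reasoning
  β = vec x Vec.++ vec (firsts k bs)

∈-toList⇒lookup : ∀ {n} (c : Vec Bool n) → true ∈ toList c → ∃ λ i → lookup c i ≡ true
∈-toList⇒lookup (b ∷ c) (here refl) = zero , refl
∈-toList⇒lookup (b ∷ c) (there i) with ∈-toList⇒lookup c i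
... | j , e = suc j , e

lookup⇒∈-toList : ∀ {n} (c : Vec Bool n) i → lookup c i ≡ true → true ∈ toList c
lookup⇒∈-toList (b ∷ c) zero refl = here refl
lookup⇒∈-toList (b ∷ c) (suc i) e = there (lookup⇒∈-toList c i e)

module _ (ts : List ℕ) where
  open Stacked ts

  weight⇒entry : ∀ k p q x bs → weight (χ (p & q)) k x bs ≢ 0 → (j : Fin k) → entry ts k p q x bs (toℕ j) ≡ false
  weight⇒entry (suc k) p q x (b & bs) nz zero =
    trans (entry-zero ts k p q x b bs) (χ≢0 (p & q) (x & b) (*-nonzeroˡ (χ (p & q) (x & b)) nz))
  weight⇒entry (suc k) p q x (b & bs) nz (suc j) = trans (entry-suc ts k p q x b bs (toℕ j))
    (weight⇒entry k p q (step ts (x & b)) bs (*-nonzeroʳ (χ (p & q) (x & b)) nz) j)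

  entry⇒weight : ∀ k p q x bs → ((j : Fin k) → entry ts k p q x bs (toℕ j) ≡ false) → weight (χ (p & q)) k x bs ≡ 1
  entry⇒weight zero p q x bs _ = refl
  entry⇒weight (suc k) p q x (b & bs) v = cong₂ _*_
    (χ≡1 (p & q) (x & b) (trans (sym (entry-zero ts k p q x b bs)) (v zero)))
    (entry⇒weight k p q (step ts (x & b)) bs λ j → trans (sym (entry-suc ts k p q x b bs (toℕ j))) (v (suc j)))

  full⇒rank : ∀ k x bs → full k (x & bs) ≢ 0 → FullRowRank (matrix ts k x bs)
  full⇒rank k x bs nz c (i , ci) z
    with coeffs-surjective ts (toList c) (trans (length-toList c) (length-matrix ts k x bs))
  ... | p , q , e with (p & q) ≟0#
  ... | yes refl = true∉coeffs-0# ts (subst (true ∈_) (sym e) (lookup⇒∈-toList c i ci))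
  ... | no w≢0 = 0≢1+n (trans (sym (avoids-∈ nz (∈-nonzeros (p & q) w≢0)))
    (entry⇒weight k p q x bs λ j → trans (sym (lincomb-matrix ts k p q x bs j))
      (trans (cong (λ l → lincomb l (matrix ts k x bs) j) e) (z j))))

  rank⇒full : ∀ k x bs → FullRowRank (matrix ts k x bs) → full k (x & bs) ≢ 0
  rank⇒full k x bs rank = avoids≢0 k x bs (All.map zero-weight (all-filter (λ x → ¬? (x ≟0#)) (elems (St ts ⊗ In ts))))
    where
    zero-weight : ∀ {w} → w ≢ 0# → weight (χ w) k x bs ≡ 0
    zero-weight {p & q} w≢0 with weight (χ (p & q)) k x bs ≟ 0
    ... | yes e = e
    ... | no ne = ⊥-elim (rank c (∈-toList⇒lookup c (subst (true ∈_) (sym e) (true∈coeffs ts p q w≢0)))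
      λ j → trans (cong (λ l → lincomb l (matrix ts k x bs) j) e)
                  (trans (lincomb-matrix ts k p q x bs j) (weight⇒entry k p q x bs ne j)))
      where
      same-length : length (coeffs ts p q) ≡ length (matrix ts k x bs)
      same-length = trans (length-coeffs ts p q) (sym (length-matrix ts k x bs))
      c : Vec Bool (length (matrix ts k x bs))
      c = Vec.cast same-length (Vec.fromList (coeffs ts p q))
      e : toList c ≡ coeffs ts p q
      e = trans (toList-cast same-length (Vec.fromList (coeffs ts p q))) (toList∘fromList (coeffs ts p q))

  param : ∀ k → ⟦ St ts ⊗ pow k (In ts) ⟧ → Vec Bool (numParams k (map suc ts))
  param k (x & bs) = params ts k x bs

  param-injective : ∀ k {u v} → param k u ≡ param k v → u ≡ v
  param-injective k {x & bs} {x' & bs'} e with params-injective ts k x bs x' bs' e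
  ... | refl , refl = refl

  full? : ∀ k u → Dec (full k u ≢ 0)
  full? k u = ¬? (full k u ≟ 0)

  ∈-fulls⇔rank : ∀ k α → (α ∈ map (param k) (fulls k)) ⇔ FullRowRank (stackedRows k (map suc ts) α)
  ∈-fulls⇔rank k α with params-surjective ts k α
  ... | x , bs , refl = mk⇔ to from
    where
    to : params ts k x bs ∈ map (param k) (fulls k) → FullRowRank (matrix ts k x bs)
    to i with ∈-map⁻ (param k) i
    ... | u , u∈ , e with param-injective k {x & bs} {u} e
    ... | refl = full⇒rank k x bs (proj₂ (∈-filter⁻ (full? k) {xs = elems _} u∈))
    from : FullRowRank (matrix ts k x bs) → params ts k x bs ∈ map (param k) (fulls k)
    from rank = ∈-map⁺ (param k) (∈-filter⁺ (full? k) (∈-elems (x & bs)) (rank⇒full k x bs rank))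

sum-map-suc : ∀ ts → sum (map suc ts) ≡ length ts + sum ts
sum-map-suc [] = refl
sum-map-suc (t ∷ ts) = cong suc (trans (cong (t +_) (sum-map-suc ts))
  (trans (sym (+-assoc t (length ts) (sum ts)))
  (trans (cong (_+ sum ts) (+-comm t (length ts))) (+-assoc (length ts) t (sum ts)))))

-- Stated for variable `m` and `ss`, so that the result for `map suc ts` can be transported to
-- `blockSizes` by one `subst₂`.
CountFullRank : (k m : ℕ) → List ℕ → Set
CountFullRank k m ss = Σ (List (Vec Bool (numParams k ss))) λ L →
  Unique L ×
  ((α : Vec Bool (numParams k ss)) → (α ∈ L) ⇔ FullRowRank (stackedRows k ss α)) ×
  (length L ≡ formula m k (sum ss))

countFullRank : ∀ k ts → sum (map suc ts) ≤ k → CountFullRank k (length ts) (map suc ts)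
countFullRank k ts δ≤k =
  map (param ts k) (fulls k) ,
  Unique.map⁺ (λ {u} {v} → param-injective ts k {u} {v}) (Unique.filter⁺ (full? ts k) (elems-unique _)) ,
  ∈-fulls⇔rank ts k ,
  trans (length-map (param ts k) (fulls k)) (ℤ.+-injective (begin
    ℤ.+ length (fulls k)
      ≡⟨ cong (λ n → ℤ.+ length (fulls n)) k≡j+D ⟩
    ℤ.+ length (fulls (j + sum ts))
      ≡⟨ length-fulls j ⟩
    2^ (sum ts + sum ts * length ts) ℤ.* falling (length ts) j
      ≡⟨ formula-falling (sum ts) (length ts) j m≤j ⟨
    ℤ.+ formula (length ts) (j + sum ts) (length ts + sum ts)
      ≡⟨ cong₂ (λ k δ → ℤ.+ formula (length ts) k δ) (sym k≡j+D) (sym (sum-map-suc ts)) ⟩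
    ℤ.+ formula (length ts) k (sum (map suc ts)) ∎))
  where
  open Stacked ts
  open ≡-Reasoning
  j = k ∸ sum ts
  m+D≤k : length ts + sum ts ≤ k
  m+D≤k = subst (_≤ k) (sum-map-suc ts) δ≤k
  k≡j+D : k ≡ j + sum ts
  k≡j+D = sym (m∸n+n≡m (≤-trans (m≤n+m (sum ts) (length ts)) m+D≤k))
  m≤j : length ts ≤ j
  m≤j = m+n≤o⇒m≤o∸n (length ts) m+D≤k

theorem7p1 : (m k a b c : ℕ) → 4 ≤ m → 1 ≤ k → 2 ≤ a → a ≤ b → b ≤ c →
    delta m a b c ≤ k →
    Σ (List (Vec Bool (numParams k (blockSizes m a b c)))) λ L →
    Unique L ×
    ((α : Vec Bool (numParams k (blockSizes m a b c))) →
    (α ∈ L) ⇔ FullRowRank (stackedRows k (blockSizes m a b c) α)) ×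
    (length L ≡ formula m k (delta m a b c))
theorem7p1 m k (suc a) (suc b) (suc c) 4≤m _ _ (s≤s _) (s≤s _) δ≤k =
  subst₂ (CountFullRank k) length-ts sizes (countFullRank k ts (subst (λ ss → sum ss ≤ k) (sym sizes) δ≤k))
  where
  ts : List ℕ
  -- Register lengths are s_i - 1, so each single row gets an empty register.
  ts = replicate (m ∸ 3) 0 ++ (a ∷ b ∷ c ∷ [])
  sizes : map suc ts ≡ blockSizes m (suc a) (suc b) (suc c)
  sizes = trans (map-++ suc (replicate (m ∸ 3) 0) _)
                (cong (_++ (suc a ∷ suc b ∷ suc c ∷ [])) (map-replicate suc (m ∸ 3) 0))
  length-ts : length ts ≡ m
  length-ts = trans (length-++ (replicate (m ∸ 3) 0))
    (trans (cong (_+ 3) (length-replicate (m ∸ 3))) (m∸n+n≡m (≤-trans (n≤1+n 3) 4≤m)))
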